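{- Let $F:2^{[d]}\to\mathbb{R}$ be monotone and normalized, and assume $F$ is $(\gamma_k,\beta_{k,d})$-weakly modular. Let $S^*$ be an optimal solution of $\max\{F(S): S\subseteq[d],\ |S|\le k\}$ and let $\tilde F:=F([d])-F(S^*)$. For any $\epsilon>0$ and $\delta\in(0,1)$, if $$T\ \ge\ \left\lceil\left(\frac{1}{\gamma_k\,\beta_{k,d}}\cdot\frac{\tilde F+\epsilon}{\epsilon}\right)^{k}\log\delta^{ -1}\right\rceil,$$ then the randomized algorithm that executes SingleRun() $T$ times (independently) and returns the best of the resulting solutions returns a solution $S$ satisfying $F(S)\ge F(S^*)-\epsilon$ with probability at least $1-\delta$.
   Context: $d,k$ are positive integers with $k\le d$, and $[d]=\{1,\dots,d\}$. For $F:2^{[d]}\to\mathbb{R}$ write $F(T\mid S):=F(S\cup T)-F(S)$ and $F(j\mid S):=F(\{j\}\mid S)$. $F$ is monotone if $F(T\mid S)\ge0$ for all $S,T\subseteq[d]$, and normalized if $F(\emptyset)=0$. Submodularity and supermodularity ratios: for $U\subseteq[d]$ and a positive integer $s$, $\gamma_{U,s}\in[0,1]$ and $\beta_{U,s}\in[0,1]$ are the largest scalars in $[0,1]$ such that $$\gamma_{U,s}\,F(T\mid L)\ \le\ \sum_{j\in T}F(j\mid L)\ \le\ \beta_{U,s}^{ -1}\,F(T\mid L)$$ for all disjoint $L,T\subseteq[d]$ with $L\subseteq U$ and $|T|\le s$. Set $\gamma_{s',s}:=\min_{|U|\le s'}\gamma_{U,s}$, $\beta_{s',s}:=\min_{|U|\le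 s'}\beta_{U,s}$ and $\gamma_s:=\gamma_{s,s}$. $F$ is $(\gamma_k,\beta_{k,d})$-weakly modular if $\gamma_k$ and $\beta_{k,d}$ are bounded below by positive numbers. SingleRun(): set $S_0=\emptyset$; for $i=1,\dots,k$, choose $j\in[d]\setminus S_{i-1}$ at random with probability proportional to $F(j\mid S_{i-1})$ and set $S_i=S_{i-1}\cup\{j\}$; return $S_k$. (If $F(j\mid S_{i-1})=0$ for all $j\in[d]\setminus S_{i-1}$, then $j$ is chosen arbitrarily.) "Best" means with largest value of $F$. -}

module Defs where

open import Level using (0ℓ) renaming (suc to lsuc)
open import Algebra.Bundles using (CommutativeRing; Semiring)
import Algebra.Definitions.RawSemiring as RawSemiringDefs
open import Data.Bool.Base using (if_then_else_)
open import Data.Fin.Base using (Fin)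
open import Data.Fin.Properties using (all?)
open import Data.Fin.Subset
  using (Subset; _∈_; _∉_; _⊆_; _∩_; _∪_; ∁; ⊥; ⁅_⁆; ∣_∣; Empty; Nonempty)
open import Data.Fin.Subset.Properties using (_∈?_)
open import Data.List.Base as List using (List; []; _∷_; allFin)
import Data.List.Extrema as Extrema
open import Data.Nat.Base as ℕ using (ℕ; zero; suc)
open import Data.Product.Base using (_×_; _,_; ∃-syntax)
open import Function.Base using (_∘_)
open import Relation.Binary.Bundles using (DecTotalOrder)
open import Relation.Binary.Core using (Rel)
open import Relation.Binary.Structures using (IsDecTotalOrder)
import Relation.Binary.Properties.DecTotalOrder as DecTotalOrderProperties
open import Relation.Nullary.Decidable using (Dec; does; ¬?; _→-dec_)
open import Relation.Nullary.Negation using (¬_)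
open import Relation.Unary using (Pred; Decidable; Satisfiable)

module Extremal {A : Set} (_≤_ : Rel A 0ℓ) where

  UpperBound : Pred A 0ℓ → Pred A 0ℓ
  UpperBound P u = ∀ x → P x → x ≤ u

  LowerBound : Pred A 0ℓ → Pred A 0ℓ
  LowerBound P l = ∀ x → P x → l ≤ x

  IsMaximum IsMinimum IsSupremum : Pred A 0ℓ → Pred A 0ℓ
  IsMaximum P m = P m × UpperBound P m
  IsMinimum P m = P m × LowerBound P m
  IsSupremum P  = IsMinimum (UpperBound P)

-- The axioms of ℝ as used classically: a Dedekind-complete ordered field with
-- decidable order.  Up to isomorphism ℝ is the only such structure.

record RealNumbers : Set (lsuc 0ℓ) where
  infix 4 _≤_
  infix 8 _⁻¹

  field
    commutativeRing : CommutativeRing 0ℓ 0ℓ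

  open CommutativeRing commutativeRing public hiding (_≉_)

  field
    _≤_             : Rel Carrier 0ℓ
    isDecTotalOrder : IsDecTotalOrder _≈_ _≤_
    +-monoˡ-≤       : ∀ z {x y} → x ≤ y → x + z ≤ y + z
    *-nonNeg        : ∀ {x y} → 0# ≤ x → 0# ≤ y → 0# ≤ x * y
    0≉1             : ¬ 0# ≈ 1#

    -- Total by convention; the value of 0# ⁻¹ is unspecified.
    _⁻¹             : Carrier → Carrier
    ⁻¹-cong         : ∀ {x y} → x ≈ y → x ⁻¹ ≈ y ⁻¹
    ⁻¹-inverseʳ     : ∀ {x} → ¬ x ≈ 0# → x * x ⁻¹ ≈ 1#

  decTotalOrder : DecTotalOrder 0ℓ 0ℓ 0ℓ
  decTotalOrder = record { isDecTotalOrder = isDecTotalOrder }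

  open DecTotalOrder decTotalOrder public
    using (_≟_; _≤?_; totalOrder)
  open DecTotalOrderProperties decTotalOrder public
    using (_<_)
  open RawSemiringDefs (Semiring.rawSemiring semiring) public
    using (_^_; sum) renaming (_×_ to _·_)

  open Extremal _≤_ public

  field
    complete : (P : Pred Carrier 0ℓ) → Satisfiable P →
               Satisfiable (UpperBound P) → Satisfiable (IsSupremum P)

module Analysis (ℝ : RealNumbers) where
  open RealNumbers ℝ

  fromℕ : ℕ → Carrier
  fromℕ n = n · 1#

  ConvergesTo : (ℕ → Carrier) → Carrier → Set
  ConvergesTo a l = ∀ ε → 0# < ε → ∃[ N ] (∀ n → N ℕ.≤ n →
                    (l - ε ≤ a n) × (a n ≤ l + ε))

  -- y = eˣ, with eˣ = lim (1 + x/n)ⁿ; the index is shifted to avoid n = 0.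
  IsExp : Carrier → Carrier → Set
  IsExp x y = ConvergesTo (λ n → (1# + x * fromℕ (suc n) ⁻¹) ^ suc n) y

  -- l = log y
  IsLog : Carrier → Carrier → Set
  IsLog y l = IsExp l y

  -- n = ⌈x⌉, for reals whose ceiling is a natural number
  IsCeiling : Carrier → ℕ → Set
  IsCeiling x n = (x ≤ fromℕ n) × (fromℕ n < x + 1#)

-- Finitely supported distributions, as lists of weighted outcomes (an outcome
-- may occur several times; its probability is the sum of its weights).

module Probability (ℝ : RealNumbers) where
  open RealNumbers ℝ

  Dist : Set → Set
  Dist A = List (Carrier × A)

  return : ∀ {A} → A → Dist A
  return a = (1# , a) ∷ []

  infixl 1 _>>=_
  _>>=_ : ∀ {A B} → Dist A → (A → Dist B) → Dist B
  D >>= f = List.concatMap (λ (p , a) → List.map (λ (q , b) → p * q , b) (f a)) D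

  Pr : ∀ {A} {P : Pred A 0ℓ} → Dist A → Decidable P → Carrier
  Pr D P? = List.foldr (λ (p , a) s → (if does (P? a) then p else 0#) + s) 0# D

  record IsPMFOn {d : ℕ} (A : Subset d) (p : Fin d → Carrier) : Set where
    field
      nonNeg : ∀ j → 0# ≤ p j
      off    : ∀ j → j ∉ A → p j ≈ 0#
      total  : sum p ≈ 1#

  fromPMF : ∀ {d} → (Fin d → Carrier) → Dist (Fin d)
  fromPMF {d} p = List.map (λ j → p j , j) (allFin d)

  -- The results of n independent runs, the t-th run having law D t.
  independently : ∀ {A} → (ℕ → Dist A) → ℕ → Dist (List A)
  independently D zero    = return []
  independently D (suc n) = D n >>= λ a → independently D n >>= λ as → return (a ∷ as)

module SetFunction (ℝ : RealNumbers) {d : ℕ}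
                   (F : Subset d → RealNumbers.Carrier ℝ) where
  open RealNumbers ℝ
  open Probability ℝ

  F⟨_∣_⟩ : Subset d → Subset d → Carrier
  F⟨ T ∣ S ⟩ = F (S ∪ T) - F S

  f⟨_∣_⟩ : Fin d → Subset d → Carrier
  f⟨ j ∣ S ⟩ = F⟨ ⁅ j ⁆ ∣ S ⟩

  ∑[_] : Subset d → (Fin d → Carrier) → Carrier
  ∑[ T ] f = sum (λ j → if does (j ∈? T) then f j else 0#)

  Monotone : Set
  Monotone = ∀ S T → 0# ≤ F⟨ T ∣ S ⟩

  Normalized : Set
  Normalized = F ⊥ ≈ 0#

  OptimalSolution : ℕ → Subset d → Set
  OptimalSolution k S* = ∣ S* ∣ ℕ.≤ k × (∀ S → ∣ S ∣ ℕ.≤ k → F S ≤ F S*)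

  ForAdmissible : Subset d → ℕ → (Subset d → Subset d → Set) → Set
  ForAdmissible U s Q =
    ∀ L T → Empty (L ∩ T) → L ⊆ U → ∣ T ∣ ℕ.≤ s → Q L T

  SubmodularityBound : Subset d → ℕ → Pred Carrier 0ℓ
  SubmodularityBound U s γ = (0# ≤ γ) × (γ ≤ 1#) ×
    ForAdmissible U s (λ L T → γ * F⟨ T ∣ L ⟩ ≤ ∑[ T ] (λ j → f⟨ j ∣ L ⟩))

  -- For β = 0 the factor β⁻¹ is +∞, so that the inequality is void.
  SupermodularityBound : Subset d → ℕ → Pred Carrier 0ℓ
  SupermodularityBound U s β = (0# ≤ β) × (β ≤ 1#) ×
    ForAdmissible U s (λ L T →
      0# < β → ∑[ T ] (λ j → f⟨ j ∣ L ⟩) ≤ β ⁻¹ * F⟨ T ∣ L ⟩)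

  -- γ_{U,s} and β_{U,s}
  IsSubmodularityRatio IsSupermodularityRatio : Subset d → ℕ → Pred Carrier 0ℓ
  IsSubmodularityRatio   U s = IsMaximum (SubmodularityBound U s)
  IsSupermodularityRatio U s = IsMaximum (SupermodularityBound U s)

  -- γ_{s′,s} and β_{s′,s}
  IsMinSubmodularityRatio IsMinSupermodularityRatio : ℕ → ℕ → Pred Carrier 0ℓ
  IsMinSubmodularityRatio s′ s =
    IsMinimum (λ γ → ∃[ U ] ∣ U ∣ ℕ.≤ s′ × IsSubmodularityRatio U s γ)
  IsMinSupermodularityRatio s′ s =
    IsMinimum (λ β → ∃[ U ] ∣ U ∣ ℕ.≤ s′ × IsSupermodularityRatio U s β)

  WeaklyModular : Carrier → Carrier → Set
  WeaklyModular γ β = (∃[ c ] 0# < c × c ≤ γ) × (∃[ c ] 0# < c × c ≤ β)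

  -- The elements selected so far in a run, latest first.
  History : Set
  History = List (Fin d)

  selected : History → Subset d
  selected = List.foldr (λ j S → S ∪ ⁅ j ⁆) ⊥

  -- How an element is chosen when all marginal gains vanish: an arbitrary
  -- distribution on the elements not yet selected (possibly a point mass),
  -- which may depend on the history of the run.
  Fallback : Set
  Fallback = History → Fin d → Carrier

  ValidFallback : Fallback → Set
  ValidFallback arb =
    ∀ h → Nonempty (∁ (selected h)) → IsPMFOn (∁ (selected h)) (arb h)

  stuck? : (S : Subset d) → Dec (∀ j → j ∉ S → f⟨ j ∣ S ⟩ ≈ 0#)
  stuck? S = all? (λ j → ¬? (j ∈? S) →-dec (f⟨ j ∣ S ⟩ ≟ 0#))

  proportional : Subset d → Fin d → Carrier
  proportional S j =
    if does (j ∈? S) then 0#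
    else f⟨ j ∣ S ⟩ * (∑[ ∁ S ] (λ i → f⟨ i ∣ S ⟩)) ⁻¹

  choose : Fallback → History → Dist (Fin d)
  choose arb h =
    fromPMF (if does (stuck? (selected h)) then arb h else proportional (selected h))

  runHistory : Fallback → ℕ → Dist History
  runHistory arb zero    = return []
  runHistory arb (suc i) =
    runHistory arb i >>= λ h → choose arb h >>= λ j → return (j ∷ h)

  singleRun : Fallback → ℕ → Dist (Subset d)
  singleRun arb k = runHistory arb k >>= (return ∘ selected)

  -- The value on [] only matters for zero runs.
  best : List (Subset d) → Subset d
  best []       = ⊥
  best (S ∷ Ss) = Extrema.argmax totalOrder F S Ss

  -- The t-th run resolves its arbitrary choices by arb t.
  bestOfRuns : (ℕ → Fallback) → (k T : ℕ) → Dist (Subset d)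
  bestOfRuns arb k T =
    independently (λ t → singleRun (arb t) k) T >>= (return ∘ best)

{-# OPTIONS --safe #-}

-- While F(S) < F(S*) - ε, weak modularity gives
--   Σ_{j ∈ S* ∖ S} F(j ∣ S) ≥ γ (F(S*) - F(S))  and
--   Σ_{j ∉ S} F(j ∣ S) ≤ β⁻¹ (F([d]) - F(S)),
-- so the next element lies in S* with probability at least
-- q = γ β ε / (F̃ + ε).  A run choosing k elements of S* returns S* itself, and
-- by monotonicity F(S) ≥ F(S*) - ε persists once reached; hence a single run
-- succeeds with probability at least qᵏ, and T runs all fail with probability
-- at most (1 - qᵏ)ᵀ ≤ δ.

module Submission where

import Algebra.Properties.AbelianGroup as AbelianGroupProperties
import Algebra.Properties.CommutativeSemiring.Exp as ExpProperties
import Algebra.Properties.Ring as RingProperties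
import Algebra.Properties.Semiring.Mult as MultProperties
import Algebra.Properties.Semiring.Sum as SumProperties
import Algebra.Solver.Ring.NaturalCoefficients.Default as NaturalSolver
open import Data.Bool.Base using (if_then_else_)
open import Data.Fin.Base using (Fin; zero; suc)
open import Data.Fin.Subset
  using (Subset; inside; outside; _∈_; _∉_; _⊆_; _⊂_; _∩_; _∪_; ∁; ⊤; ⁅_⁆; ∣_∣; Empty; Nonempty)
open import Data.Fin.Subset.Properties
open import Data.List.Base as List using (List; []; _∷_; _++_; length; tabulate; allFin)
import Data.List.Extrema as Extrema
open import Data.List.Relation.Unary.All as All using (All; []; _∷_)
import Data.List.Relation.Unary.All.Properties as All
open import Data.Nat.Base as ℕ using (ℕ; zero; suc; NonZero)
import Data.Nat.Properties as ℕₚ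
open import Data.Product.Base using (_×_; _,_; proj₁; proj₂; ∃-syntax)
open import Data.Sum.Base using (_⊎_; inj₁; inj₂; [_,_]′)
open import Data.Unit.Base using (tt)
open import Data.Vec.Base using (_∷_)
open import Function.Base using (_∘_; _$_; id; const)
open import Level using (0ℓ)
open import Relation.Binary.Bundles using (DecTotalOrder)
import Relation.Binary.Properties.DecTotalOrder as DecTotalOrderProperties
open import Relation.Binary.PropositionalEquality as ≡ using (_≡_)
import Relation.Binary.Reasoning.PartialOrder as PartialOrderReasoning
open import Relation.Nullary.Decidable
  using (Dec; yes; no; does; dec-true; dec-false; decidable-stable; ¬?; _⊎-dec_)
open import Relation.Nullary.Negation using (¬_; contradiction)
open import Relation.Unary using (Pred; Decidable; Satisfiable) renaming (U to Always)
open import Defs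

-- The closing inequality `(1 - qᵏ)ᵀ ≤ δ` is where the work on real numbers goes. The logarithm
-- enters only as a number `l` for which (1 + l/n)ⁿ tends to `δ ⁻¹`, so the bound is obtained on the
-- terms of that sequence, by Bernoulli's inequality along exponents divisible by T, and then passed
-- to the limit. The ratios raise a second obstacle. `γ` and `β` are given as minima of maxima, so
-- they say something about a set U only once the maximum belonging to U is known to exist;
-- completeness of the reals supplies it. Within a run, choosing only elements of S* is not followed
-- as an event of its own. It is merged with having reached the threshold into one invariant on
-- histories. Whichever alternative holds, the invariant survives the next choice with conditional
-- probability at least `q`, so the powers of `q` accumulate by induction on the number of choices.

module OrderedField (ℝ : RealNumbers) where
  open RealNumbers ℝ hiding (zero)
  open Analysis ℝ
  open DecTotalOrder decTotalOrder public
    using (poset; ≤-respˡ-≈; ≤-respʳ-≈)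
    renaming (refl to ≤-refl; reflexive to ≤-reflexive; trans to ≤-trans;
              antisym to ≤-antisym; total to ≤-total)
  open DecTotalOrderProperties decTotalOrder public
    using (<⇒≱; ≰⇒>; ≮⇒≥)
  open RingProperties ring public using (-‿distribˡ-*; x[y-z]≈xy-xz)
  open AbelianGroupProperties +-abelianGroup public
    using (//-rightDividesˡ; //-rightDividesʳ; ⁻¹-involutive)
  open ExpProperties commutativeSemiring public using (^-distrib-*; ^-assocʳ; ^-cong)
  open MultProperties semiring public using (×1-homo-*)
  open NaturalSolver commutativeSemiring public using (solve; _:=_; _:+_; _:*_; con)
  open PartialOrderReasoning poset

  -- Arithmetic of ordered fields.

  <⇒≤ : ∀ {x y} → x < y → x ≤ y
  <⇒≤ = proj₁

  <-≤-trans : ∀ {x y z} → x < y → y ≤ z → x < z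
  <-≤-trans {x} {y} {z} x<y y≤z = begin-strict x <⟨ x<y ⟩ y ≤⟨ y≤z ⟩ z ∎

  +-monoʳ-≤ : ∀ z {x y} → x ≤ y → z + x ≤ z + y
  +-monoʳ-≤ z {x} {y} x≤y = begin
    z + x ≈⟨ +-comm z x ⟩
    x + z ≤⟨ +-monoˡ-≤ z x≤y ⟩
    y + z ≈⟨ +-comm y z ⟩
    z + y ∎

  +-mono-≤ : ∀ {x y u v} → x ≤ y → u ≤ v → x + u ≤ y + v
  +-mono-≤ {x} {y} {u} {v} x≤y u≤v = begin
    x + u ≤⟨ +-monoˡ-≤ u x≤y ⟩
    y + u ≤⟨ +-monoʳ-≤ y u≤v ⟩
    y + v ∎

  +-cancelʳ-≤ : ∀ z {x y} → x + z ≤ y + z → x ≤ y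
  +-cancelʳ-≤ z {x} {y} x+z≤y+z = begin
    x         ≈⟨ //-rightDividesʳ z x ⟨
    x + z - z ≤⟨ +-monoˡ-≤ (- z) x+z≤y+z ⟩
    y + z - z ≈⟨ //-rightDividesʳ z y ⟩
    y         ∎

  x-y≤z⇒x≤z+y : ∀ {x y z} → x - y ≤ z → x ≤ z + y
  x-y≤z⇒x≤z+y {x} {y} {z} h = begin
    x         ≈⟨ //-rightDividesˡ y x ⟨
    x - y + y ≤⟨ +-monoˡ-≤ y h ⟩
    z + y     ∎

  x≤z+y⇒x-y≤z : ∀ {x y z} → x ≤ z + y → x - y ≤ z
  x≤z+y⇒x-y≤z {x} {y} {z} h = begin
    x - y     ≤⟨ +-monoˡ-≤ (- y) h ⟩
    z + y - y ≈⟨ //-rightDividesʳ y z ⟩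
    z         ∎

  x≤y⇒0≤y-x : ∀ {x y} → x ≤ y → 0# ≤ y - x
  x≤y⇒0≤y-x {x} {y} x≤y = begin
    0#    ≈⟨ -‿inverseʳ x ⟨
    x - x ≤⟨ +-monoˡ-≤ (- x) x≤y ⟩
    y - x ∎

  0≤y-x⇒x≤y : ∀ {x y} → 0# ≤ y - x → x ≤ y
  0≤y-x⇒x≤y {x} {y} h = begin
    x         ≈⟨ +-identityˡ x ⟨
    0# + x    ≤⟨ +-monoˡ-≤ x h ⟩
    y - x + x ≈⟨ //-rightDividesˡ x y ⟩
    y         ∎

  0≤+ : ∀ {x y} → 0# ≤ x → 0# ≤ y → 0# ≤ x + y
  0≤+ {x} {y} 0≤x 0≤y = begin
    0#      ≈⟨ +-identityˡ 0# ⟨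
    0# + 0# ≤⟨ +-mono-≤ 0≤x 0≤y ⟩
    x + y   ∎

  x≤x+y : ∀ {x y} → 0# ≤ y → x ≤ x + y
  x≤x+y {x} {y} 0≤y = begin
    x      ≈⟨ +-identityʳ x ⟨
    x + 0# ≤⟨ +-monoʳ-≤ x 0≤y ⟩
    x + y  ∎

  y≤x+y : ∀ {x y} → 0# ≤ x → y ≤ x + y
  y≤x+y {x} {y} 0≤x = ≤-respʳ-≈ (+-comm y x) (x≤x+y 0≤x)

  *-monoʳ-≤ : ∀ {z x y} → 0# ≤ z → x ≤ y → z * x ≤ z * y
  *-monoʳ-≤ {z} {x} {y} 0≤z x≤y = 0≤y-x⇒x≤y $ begin
    0#            ≤⟨ *-nonNeg 0≤z (x≤y⇒0≤y-x x≤y) ⟩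
    z * (y - x)   ≈⟨ x[y-z]≈xy-xz z y x ⟩
    z * y - z * x ∎

  *-monoˡ-≤ : ∀ {z x y} → 0# ≤ z → x ≤ y → x * z ≤ y * z
  *-monoˡ-≤ {z} {x} {y} 0≤z x≤y = begin
    x * z ≈⟨ *-comm x z ⟩
    z * x ≤⟨ *-monoʳ-≤ 0≤z x≤y ⟩
    z * y ≈⟨ *-comm z y ⟩
    y * z ∎

  *-mono-≤ : ∀ {x y u v} → 0# ≤ u → 0# ≤ y → x ≤ y → u ≤ v → x * u ≤ y * v
  *-mono-≤ {x} {y} {u} {v} 0≤u 0≤y x≤y u≤v = begin
    x * u ≤⟨ *-monoˡ-≤ 0≤u x≤y ⟩
    y * u ≤⟨ *-monoʳ-≤ 0≤y u≤v ⟩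
    y * v ∎

  0≤1 : 0# ≤ 1#
  0≤1 with ≤-total 0# 1#
  ... | inj₁ 0≤1 = 0≤1
  ... | inj₂ 1≤0 = begin
    0#            ≤⟨ *-nonNeg 0≤-1 0≤-1 ⟩
    - 1# * - 1#   ≈⟨ -‿distribˡ-* 1# (- 1#) ⟨
    - (1# * - 1#) ≈⟨ -‿cong (*-identityˡ (- 1#)) ⟩
    - - 1#        ≈⟨ ⁻¹-involutive 1# ⟩
    1#            ∎
    where
    0≤-1 : 0# ≤ - 1#
    0≤-1 = ≤-respʳ-≈ (+-identityˡ (- 1#)) (x≤y⇒0≤y-x 1≤0)

  0<1 : 0# < 1#
  0<1 = 0≤1 , 0≉1

  ⁻¹-inverseˡ : ∀ {x} → ¬ x ≈ 0# → x ⁻¹ * x ≈ 1#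
  ⁻¹-inverseˡ {x} x≉0 = trans (*-comm (x ⁻¹) x) (⁻¹-inverseʳ x≉0)

  pos⇒≉0 : ∀ {x} → 0# < x → ¬ x ≈ 0#
  pos⇒≉0 (_ , 0≉x) x≈0 = 0≉x (sym x≈0)

  0<⁻¹ : ∀ {x} → 0# < x → 0# < x ⁻¹
  0<⁻¹ {x} 0<x = ≰⇒> λ x⁻¹≤0 → <⇒≱ 0<1 $ begin
    1#       ≈⟨ ⁻¹-inverseʳ (pos⇒≉0 0<x) ⟨
    x * x ⁻¹ ≤⟨ *-monoʳ-≤ (<⇒≤ 0<x) x⁻¹≤0 ⟩
    x * 0#   ≈⟨ zeroʳ x ⟩
    0#       ∎

  *-pos : ∀ {x y} → 0# < x → 0# < y → 0# < x * y
  *-pos {x} {y} 0<x 0<y = *-nonNeg (<⇒≤ 0<x) (<⇒≤ 0<y) , λ 0≈xy → pos⇒≉0 0<y $ begin-equality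
    y              ≈⟨ *-identityˡ y ⟨
    1# * y         ≈⟨ *-congʳ (⁻¹-inverseˡ (pos⇒≉0 0<x)) ⟨
    x ⁻¹ * x * y   ≈⟨ *-assoc (x ⁻¹) x y ⟩
    x ⁻¹ * (x * y) ≈⟨ *-congˡ 0≈xy ⟨
    x ⁻¹ * 0#      ≈⟨ zeroʳ (x ⁻¹) ⟩
    0#             ∎

  *-cancelʳ : ∀ {x z} → 0# < z → x * z * z ⁻¹ ≈ x
  *-cancelʳ {x} {z} 0<z = begin-equality
    x * z * z ⁻¹   ≈⟨ *-assoc x z (z ⁻¹) ⟩
    x * (z * z ⁻¹) ≈⟨ *-congˡ (⁻¹-inverseʳ (pos⇒≉0 0<z)) ⟩
    x * 1#         ≈⟨ *-identityʳ x ⟩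
    x              ∎

  x*z≤y⇒x≤y/z : ∀ {x y z} → 0# < z → x * z ≤ y → x ≤ y * z ⁻¹
  x*z≤y⇒x≤y/z {x} {y} {z} 0<z h = begin
    x            ≈⟨ *-cancelʳ 0<z ⟨
    x * z * z ⁻¹ ≤⟨ *-monoˡ-≤ (<⇒≤ (0<⁻¹ 0<z)) h ⟩
    y * z ⁻¹     ∎

  y≤x*z⇒y/z≤x : ∀ {x y z} → 0# < z → y ≤ x * z → y * z ⁻¹ ≤ x
  y≤x*z⇒y/z≤x {x} {y} {z} 0<z h = begin
    y * z ⁻¹     ≤⟨ *-monoˡ-≤ (<⇒≤ (0<⁻¹ 0<z)) h ⟩
    x * z * z ⁻¹ ≈⟨ *-cancelʳ 0<z ⟩
    x            ∎

  /-*-cancel : ∀ {x z} → 0# < z → x * z ⁻¹ * z ≈ x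
  /-*-cancel {x} {z} 0<z = begin-equality
    x * z ⁻¹ * z   ≈⟨ *-assoc x (z ⁻¹) z ⟩
    x * (z ⁻¹ * z) ≈⟨ *-congˡ (⁻¹-inverseˡ (pos⇒≉0 0<z)) ⟩
    x * 1#         ≈⟨ *-identityʳ x ⟩
    x              ∎

  0≤^ : ∀ {x} → 0# ≤ x → ∀ n → 0# ≤ x ^ n
  0≤^ 0≤x zero    = 0≤1
  0≤^ 0≤x (suc n) = *-nonNeg 0≤x (0≤^ 0≤x n)

  0<^ : ∀ {x} → 0# < x → ∀ n → 0# < x ^ n
  0<^ 0<x zero    = 0<1
  0<^ 0<x (suc n) = *-pos 0<x (0<^ 0<x n)

  ^-mono-≤ : ∀ {x y} → 0# ≤ x → x ≤ y → ∀ n → x ^ n ≤ y ^ n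
  ^-mono-≤ 0≤x x≤y zero    = ≤-refl
  ^-mono-≤ 0≤x x≤y (suc n) =
    *-mono-≤ (0≤^ 0≤x n) (≤-trans 0≤x x≤y) x≤y (^-mono-≤ 0≤x x≤y n)

  1^n≈1 : ∀ n → 1# ^ n ≈ 1#
  1^n≈1 zero    = refl
  1^n≈1 (suc n) = trans (*-identityˡ (1# ^ n)) (1^n≈1 n)

  x^n≤1 : ∀ {x} → 0# ≤ x → x ≤ 1# → ∀ n → x ^ n ≤ 1#
  x^n≤1 0≤x x≤1 n = ≤-respʳ-≈ (1^n≈1 n) (^-mono-≤ 0≤x x≤1 n)

  -- Natural numbers in the field, and bounds on the exponential limit.

  0≤fromℕ : ∀ n → 0# ≤ fromℕ n
  0≤fromℕ zero    = ≤-refl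
  0≤fromℕ (suc n) = 0≤+ 0≤1 (0≤fromℕ n)

  0<fromℕ-suc : ∀ n → 0# < fromℕ (suc n)
  0<fromℕ-suc n = <-≤-trans 0<1 (x≤x+y (0≤fromℕ n))

  fromℕ-mono-≤ : ∀ {m n} → m ℕ.≤ n → fromℕ m ≤ fromℕ n
  fromℕ-mono-≤ {n = n} ℕ.z≤n = 0≤fromℕ n
  fromℕ-mono-≤ (ℕ.s≤s m≤n)   = +-monoʳ-≤ 1# (fromℕ-mono-≤ m≤n)

  -- The order being decidable but ℕ infinite, no n exceeding u can be
  -- exhibited: the Archimedean property is only available in negated form.
  archimedean : ∀ u → ¬ (∀ n → fromℕ n ≤ u)
  archimedean u ℕ≤u = <⇒≱ 0<1 1≤0
    where
    Natural : Pred Carrier 0ℓ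
    Natural x = ∃[ n ] x ≈ fromℕ n

    sup : Satisfiable (IsSupremum Natural)
    sup = complete Natural (0# , 0 , refl)
            (u , λ x (n , x≈n) → ≤-respˡ-≈ (sym x≈n) (ℕ≤u n))

    s : Carrier
    s = proj₁ sup

    s-1-bound : UpperBound Natural (s - 1#)
    s-1-bound x (n , x≈n) = begin
      x                ≈⟨ x≈n ⟩
      fromℕ n          ≈⟨ //-rightDividesʳ 1# (fromℕ n) ⟨
      fromℕ n + 1# - 1# ≈⟨ +-congʳ (+-comm (fromℕ n) 1#) ⟩
      fromℕ (suc n) - 1# ≤⟨ +-monoˡ-≤ (- 1#) (proj₁ (proj₂ sup) _ (suc n , refl)) ⟩
      s - 1#           ∎

    1≤0 : 1# ≤ 0#
    1≤0 = +-cancelʳ-≤ s $ begin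
      1# + s      ≤⟨ +-monoʳ-≤ 1# (proj₂ (proj₂ sup) _ s-1-bound) ⟩
      1# + (s - 1#) ≈⟨ +-comm 1# (s - 1#) ⟩
      s - 1# + 1# ≈⟨ //-rightDividesˡ 1# s ⟩
      s           ≈⟨ +-identityˡ s ⟨
      0# + s      ∎

  -- Were y < x, half the distance x - y taken as ε would be at most 0. This is what carries a bound
  -- on the terms of a sequence over to its limit.
  ≤-fromAbove : ∀ {x y} → (∀ ε → 0# < ε → x - ε ≤ y) → x ≤ y
  ≤-fromAbove {x} {y} x-ε≤y = ≮⇒≥ λ y<x →
    let 2#   = 1# + 1#
        0<2  = <-≤-trans 0<1 (x≤x+y 0≤1)
        D    = x - y
        0<D  = ≰⇒> λ D≤0 → <⇒≱ y<x (≤-respʳ-≈ (+-identityˡ y) (x-y≤z⇒x≤z+y D≤0))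
        h    = D * 2# ⁻¹
        0<h  = *-pos 0<D (0<⁻¹ 0<2)
        h+h  = begin-equality
          h + h   ≈⟨ solve 1 (λ a → a :+ a := a :* (con 1 :+ con 1)) refl h ⟩
          h * 2#  ≈⟨ /-*-cancel 0<2 ⟩
          D       ∎
    in <⇒≱ 0<h $ +-cancelʳ-≤ h $ begin
         h + h   ≈⟨ h+h ⟩
         x - y   ≤⟨ x≤z+y⇒x-y≤z (≤-respʳ-≈ (+-comm y h) (x-y≤z⇒x≤z+y (x-ε≤y h 0<h))) ⟩
         h       ≈⟨ +-identityˡ h ⟨
         0# + h  ∎

  -- Bernoulli's inequality (1 - x)ⁿ ≥ 1 - n x, with `u` standing for 1 - x and every term moved to
  -- the side where it is positive, so that the semiring solver applies.
  bernoulli : ∀ {u x} → 0# ≤ u → 0# ≤ x → u + x ≈ 1# → ∀ n → 1# ≤ u ^ n + fromℕ n * x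
  bernoulli {u} {x} 0≤u 0≤x u+x≈1 zero = x≤x+y (≤-reflexive (sym (zeroˡ x)))
  bernoulli {u} {x} 0≤u 0≤x u+x≈1 (suc n) = begin
    1#                                   ≈⟨ u+x≈1 ⟨
    u + x                                ≈⟨ +-congʳ (*-identityʳ u) ⟨
    u * 1# + x
      ≤⟨ +-monoˡ-≤ x (*-monoʳ-≤ 0≤u (bernoulli 0≤u 0≤x u+x≈1 n)) ⟩
    -- The added `x * nx` completes `u * nx` to `(u + x) * nx`, which is `nx`.
    u * (u ^ n + nx) + x                 ≤⟨ x≤x+y (*-nonNeg 0≤x (*-nonNeg (0≤fromℕ n) 0≤x)) ⟩
    u * (u ^ n + nx) + x + x * nx
      ≈⟨ solve 4 (λ a b c y → a :* (b :+ c) :+ y :+ y :* c := (a :* b :+ y) :+ (a :+ y) :* c)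
           refl u (u ^ n) nx x ⟩
    u * u ^ n + x + (u + x) * nx         ≈⟨ +-congˡ (trans (*-congʳ u+x≈1) (*-identityˡ nx)) ⟩
    u * u ^ n + x + nx                   ≈⟨ +-assoc (u * u ^ n) x nx ⟩
    u * u ^ n + (x + nx)
      ≈⟨ +-congˡ (trans (distribʳ x 1# (fromℕ n)) (+-congʳ (*-identityˡ x))) ⟨
    u * u ^ n + (1# + fromℕ n) * x       ∎
    where nx = fromℕ n * x

  -- From (1 - z)^m ≥ 1 - m z one gets (1 + z)^m (1 - m z) ≤ (1 - z²)^m ≤ 1.
  [1+z]^m*u≤1 : ∀ {u z} m → 0# ≤ u → 0# ≤ z → u + fromℕ (suc m) * z ≈ 1# →
                (1# + z) ^ suc m * u ≤ 1#
  [1+z]^m*u≤1 {u} {z} m 0≤u 0≤z u+mz≈1 = begin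
    (1# + z) ^ suc m * u         ≤⟨ *-monoʳ-≤ (0≤^ 0≤1+z (suc m)) u≤w^m ⟩
    (1# + z) ^ suc m * w ^ suc m ≈⟨ ^-distrib-* (1# + z) w (suc m) ⟨
    ((1# + z) * w) ^ suc m       ≤⟨ x^n≤1 (*-nonNeg 0≤1+z 0≤w) [1+z]w≤1 (suc m) ⟩
    1#                           ∎
    where
    w : Carrier
    w = 1# - z

    w+z≈1 : w + z ≈ 1#
    w+z≈1 = //-rightDividesˡ z 1#

    z≤1 : z ≤ 1#
    z≤1 = begin
      z                       ≈⟨ *-identityˡ z ⟨
      1# * z                  ≤⟨ *-monoˡ-≤ 0≤z (x≤x+y (0≤fromℕ m)) ⟩
      fromℕ (suc m) * z       ≤⟨ y≤x+y 0≤u ⟩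
      u + fromℕ (suc m) * z   ≈⟨ u+mz≈1 ⟩
      1#                      ∎

    0≤w : 0# ≤ w
    0≤w = x≤y⇒0≤y-x z≤1

    w≤1 : w ≤ 1#
    w≤1 = ≤-respʳ-≈ w+z≈1 (x≤x+y 0≤z)

    0≤1+z : 0# ≤ 1# + z
    0≤1+z = 0≤+ 0≤1 0≤z

    u≤w^m : u ≤ w ^ suc m
    u≤w^m = +-cancelʳ-≤ (fromℕ (suc m) * z) $
      ≤-respˡ-≈ (sym u+mz≈1) (bernoulli 0≤w 0≤z w+z≈1 (suc m))

    [1+z]w≤1 : (1# + z) * w ≤ 1#
    [1+z]w≤1 = begin
      (1# + z) * w   ≈⟨ distribʳ w 1# z ⟩
      1# * w + z * w ≤⟨ +-mono-≤ (≤-reflexive (*-identityˡ w)) (*-monoʳ-≤ 0≤z w≤1) ⟩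
      w + z * 1#     ≈⟨ +-congˡ (*-identityʳ z) ⟩
      w + z          ≈⟨ w+z≈1 ⟩
      1#             ∎

  -- In classical terms u = 1 - p ≤ exp(-p), hence y u^(t+1) ≤ exp(x - (t+1) p) ≤ 1. Here `r ⁻¹`
  -- bounds terms of arbitrarily large index in the sequence converging to `y`, and therefore `y`
  -- itself. The case r = 0 is separate because `0# ⁻¹` is unspecified.
  exp-bound : ∀ {x y u p} t → IsExp x y → 0# ≤ u → 0# ≤ p → u + p ≈ 1# →
              x ≤ fromℕ (suc t) * p → y * u ^ suc t ≤ 1#
  exp-bound {x} {y} {u} {p} t exp 0≤u 0≤p u+p≈1 x≤tp with u ^ suc t ≟ 0#
  ... | yes r≈0 = begin
    y * u ^ suc t ≈⟨ *-congˡ r≈0 ⟩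
    y * 0#        ≈⟨ zeroʳ y ⟩
    0#            ≤⟨ 0≤1 ⟩
    1#            ∎
  ... | no r≉0 = begin
    y * r    ≤⟨ *-monoˡ-≤ (<⇒≤ 0<r) (≤-fromAbove y-ε≤r⁻¹) ⟩
    r ⁻¹ * r ≈⟨ ⁻¹-inverseˡ r≉0 ⟩
    1#       ∎
    where
    r : Carrier
    r = u ^ suc t

    0<r : 0# < r
    0<r = 0≤^ 0≤u (suc t) , r≉0 ∘ sym

    -- The terms of index n + 1 = M (t + 1) of the sequence defining eˣ are
    -- bounded by ((1 + p/M)^M)^(t+1) once n + 1 ≥ -x.
    term≤r⁻¹ : ∀ m → - x ≤ fromℕ (suc m) → let n = t ℕ.+ m ℕ.* suc t in
               (1# + x * fromℕ (suc n) ⁻¹) ^ suc n ≤ r ⁻¹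
    term≤r⁻¹ m -x≤m = begin
      (1# + x * fromℕ K ⁻¹) ^ K   ≤⟨ ^-mono-≤ 0≤1+x/K (+-monoʳ-≤ 1# x/K≤z) K ⟩
      (1# + z) ^ (M ℕ.* suc t)    ≈⟨ ^-assocʳ (1# + z) M (suc t) ⟨
      ((1# + z) ^ M) ^ suc t      ≈⟨ *-cancelʳ 0<r ⟨
      ((1# + z) ^ M) ^ suc t * r * r ⁻¹ ≈⟨ *-congʳ (^-distrib-* ((1# + z) ^ M) u (suc t)) ⟨
      ((1# + z) ^ M * u) ^ suc t * r ⁻¹
        ≤⟨ *-monoˡ-≤ 0≤r⁻¹ (x^n≤1 (*-nonNeg (0≤^ (0≤+ 0≤1 0≤z) M) 0≤u)
                                     ([1+z]^m*u≤1 m 0≤u 0≤z u+Mz≈1) (suc t)) ⟩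
      1# * r ⁻¹                   ≈⟨ *-identityˡ (r ⁻¹) ⟩
      r ⁻¹                        ∎
      where
      M K : ℕ
      M = suc m
      -- This product reduces to `suc n` for the index `n` in the statement, so the exponent of the
      -- sequence is already in factored form.
      K = M ℕ.* suc t

      z : Carrier
      z = p * fromℕ M ⁻¹

      0≤r⁻¹ = <⇒≤ (0<⁻¹ 0<r)
      0<M = 0<fromℕ-suc m
      0<K = 0<fromℕ-suc (t ℕ.+ m ℕ.* suc t)

      0≤z : 0# ≤ z
      0≤z = *-nonNeg 0≤p (<⇒≤ (0<⁻¹ 0<M))

      Mz≈p : fromℕ M * z ≈ p
      Mz≈p = trans (*-comm (fromℕ M) z) (/-*-cancel 0<M)

      u+Mz≈1 : u + fromℕ M * z ≈ 1#
      u+Mz≈1 = trans (+-congˡ Mz≈p) u+p≈1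

      x/K≤z : x * fromℕ K ⁻¹ ≤ z
      x/K≤z = y≤x*z⇒y/z≤x 0<K $ begin
        x                             ≤⟨ x≤tp ⟩
        fromℕ (suc t) * p             ≈⟨ *-congˡ Mz≈p ⟨
        fromℕ (suc t) * (fromℕ M * z)
          ≈⟨ solve 3 (λ a b c → a :* (b :* c) := c :* (b :* a)) refl (fromℕ (suc t)) (fromℕ M) z ⟩
        z * (fromℕ M * fromℕ (suc t)) ≈⟨ *-congˡ (×1-homo-* M (suc t)) ⟨
        z * fromℕ K                   ∎

      -- `x` may be negative, while monotonicity of powers needs the base 1 + x/K to be nonnegative;
      -- this is the purpose of `-x≤m`.
      0≤K+x : 0# ≤ fromℕ K + x
      0≤K+x = begin
        0#          ≈⟨ -‿inverseˡ x ⟨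
        - x + x     ≤⟨ +-monoˡ-≤ x (≤-trans -x≤m (fromℕ-mono-≤ (ℕₚ.m≤m*n M (suc t)))) ⟩
        fromℕ K + x ∎

      0≤1+x/K : 0# ≤ 1# + x * fromℕ K ⁻¹
      0≤1+x/K = begin
        0#                                    ≤⟨ *-nonNeg 0≤K+x (<⇒≤ (0<⁻¹ 0<K)) ⟩
        (fromℕ K + x) * fromℕ K ⁻¹            ≈⟨ distribʳ _ _ _ ⟩
        fromℕ K * fromℕ K ⁻¹ + x * fromℕ K ⁻¹ ≈⟨ +-congʳ (⁻¹-inverseʳ (pos⇒≉0 0<K)) ⟩
        1# + x * fromℕ K ⁻¹                   ∎

    y-ε≤r⁻¹ : ∀ ε → 0# < ε → y - ε ≤ r ⁻¹
    -- The goal is a decidable inequality, hence stable under double negation, so the negated form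
    -- of the Archimedean property suffices.
    y-ε≤r⁻¹ ε 0<ε = decidable-stable (_ ≤? _) λ y-ε≰r⁻¹ →
      let N , close = exp ε 0<ε in
      archimedean (- x) λ m → ≮⇒≥ λ -x<m → y-ε≰r⁻¹ $
        -- The sum serves two demands at once: the resulting index lies beyond `N`, where the
        -- sequence is ε-close to `y`, and M + 1 exceeds -x.
        let M     = N ℕ.+ m
            N≤n   = ℕₚ.≤-trans (ℕₚ.m≤m+n N m)
                      (ℕₚ.≤-trans (ℕₚ.m≤m*n M (suc t)) (ℕₚ.m≤n+m (M ℕ.* suc t) t))
            m≤1+M = ℕₚ.m≤n⇒m≤1+n (ℕₚ.m≤n+m m N)
        in ≤-trans (proj₁ (close _ N≤n))
             (term≤r⁻¹ M (≤-trans (<⇒≤ -x<m) (fromℕ-mono-≤ m≤1+M)))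

  u^n≤δ : ∀ {δ l u p} n → 0# < δ → IsLog (δ ⁻¹) l → 0# ≤ u → 0# ≤ p → u + p ≈ 1# →
          l ≤ fromℕ n * p → u ^ n ≤ δ
  u^n≤δ {δ} {l} {u} {p} n 0<δ log 0≤u 0≤p u+p≈1 l≤np = begin
    u ^ n              ≈⟨ /-*-cancel 0<δ ⟨
    u ^ n * δ ⁻¹ * δ   ≈⟨ *-congʳ (*-comm (u ^ n) (δ ⁻¹)) ⟩
    δ ⁻¹ * u ^ n * δ   ≤⟨ *-monoˡ-≤ (<⇒≤ 0<δ) (δ⁻¹u^n≤1 n l≤np) ⟩
    1# * δ             ≈⟨ *-identityˡ δ ⟩
    δ                  ∎
    where
    δ⁻¹u^n≤1 : ∀ n → l ≤ fromℕ n * p → δ ⁻¹ * u ^ n ≤ 1#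
    δ⁻¹u^n≤1 (suc n) l≤np = exp-bound n log 0≤u 0≤p u+p≈1 l≤np
    -- `exp-bound` only covers positive exponents. For n = 0 the hypothesis says l ≤ 0, and the
    -- bound is taken at u = 1, p = 0 and exponent 1.
    δ⁻¹u^n≤1 zero    l≤0p = ≤-respˡ-≈ (*-congˡ (1^n≈1 1))
      (exp-bound 0 log 0≤1 ≤-refl (+-identityʳ 1#) (begin
        l              ≤⟨ l≤0p ⟩
        0# * p         ≈⟨ zeroˡ p ⟩
        0#             ≈⟨ zeroʳ (fromℕ 1) ⟨
        fromℕ 1 * 0#   ∎))

  -- Existence of the largest scalar satisfying a family of linear constraints.

  IsMaximum-⇔ : ∀ {P Q : Pred Carrier 0ℓ} {m} → IsMaximum P m →
                (∀ x → P x → Q x) → (∀ x → Q x → P x) → IsMaximum Q m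
  IsMaximum-⇔ (Pm , max) P⇒Q Q⇒P = P⇒Q _ Pm , λ x Qx → max x (Q⇒P x Qx)

  -- The common shape of both ratios. For γ, `a` is the joint gain and `b` the sum of single gains;
  -- for β the roles are exchanged and the inverse is cleared.
  Admissible : {I : Set} → Pred I 0ℓ → (a b : I → Carrier) → Pred Carrier 0ℓ
  Admissible P a b x = 0# ≤ x × x ≤ 1# × (∀ i → P i → x * a i ≤ b i)

  -- The supremum satisfies every constraint itself: if a i > 0, then b i / a i is an upper bound of
  -- the admissible scalars and so dominates `s`; if a i = 0, the constraint reduces to 0 ≤ b i.
  largestScalar : {I : Set} (P : Pred I 0ℓ) (a b : I → Carrier) →
                  (∀ i → P i → 0# ≤ a i) → (∀ i → P i → 0# ≤ b i) →
                  Satisfiable (IsMaximum (Admissible P a b))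
  largestScalar {I} P a b 0≤a 0≤b =
    s , (upper 0# admissible₀ , least 1# (λ x → proj₁ ∘ proj₂) , sa≤b) , upper
    where
    admissible₀ : Admissible P a b 0#
    admissible₀ = ≤-refl , 0≤1 , λ i Pi → ≤-respˡ-≈ (sym (zeroˡ (a i))) (0≤b i Pi)

    sup : Satisfiable (IsSupremum (Admissible P a b))
    sup = complete (Admissible P a b) (0# , admissible₀) (1# , λ x → proj₁ ∘ proj₂)

    s : Carrier
    s = proj₁ sup

    upper : UpperBound (Admissible P a b) s
    upper = proj₁ (proj₂ sup)

    least : LowerBound (UpperBound (Admissible P a b)) s
    least = proj₂ (proj₂ sup)

    sa≤b : ∀ i → P i → s * a i ≤ b i
    sa≤b i Pi with a i ≟ 0#
    ... | yes a≈0 = begin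
      s * a i ≈⟨ *-congˡ a≈0 ⟩
      s * 0#  ≈⟨ zeroʳ s ⟩
      0#      ≤⟨ 0≤b i Pi ⟩
      b i     ∎
    ... | no a≉0 = begin
      s * a i
        ≤⟨ *-monoˡ-≤ (0≤a i Pi) (least _ λ x (_ , _ , xa≤b) → x*z≤y⇒x≤y/z 0<a (xa≤b i Pi)) ⟩
      b i * a i ⁻¹ * a i  ≈⟨ /-*-cancel 0<a ⟩
      b i                 ∎
      where
      0<a : 0# < a i
      0<a = 0≤a i Pi , a≉0 ∘ sym

-- Finite sums of nonnegative terms.

module FiniteSums (ℝ : RealNumbers) where
  open RealNumbers ℝ hiding (zero)
  open OrderedField ℝ
  open SumProperties semiring public using (*-distribʳ-sum; sum-cong-≋)
  open PartialOrderReasoning poset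

  sum-mono-≤ : ∀ {n} {f g : Fin n → Carrier} → (∀ i → f i ≤ g i) → sum f ≤ sum g
  sum-mono-≤ {zero}  f≤g = ≤-refl
  sum-mono-≤ {suc n} f≤g = +-mono-≤ (f≤g zero) (sum-mono-≤ (f≤g ∘ suc))

  0≤sum : ∀ {n} {f : Fin n → Carrier} → (∀ i → 0# ≤ f i) → 0# ≤ sum f
  0≤sum {zero}  0≤f = ≤-refl
  0≤sum {suc n} 0≤f = 0≤+ (0≤f zero) (0≤sum (0≤f ∘ suc))

  term≤sum : ∀ {n} {f : Fin n → Carrier} → (∀ i → 0# ≤ f i) → ∀ i → f i ≤ sum f
  term≤sum 0≤f zero    = x≤x+y (0≤sum (0≤f ∘ suc))
  term≤sum 0≤f (suc i) = ≤-trans (term≤sum (0≤f ∘ suc) i) (y≤x+y (0≤f zero))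

  sum≈0 : ∀ {n} {f : Fin n → Carrier} → (∀ i → f i ≈ 0#) → sum f ≈ 0#
  sum≈0 {zero}  f≈0 = refl
  sum≈0 {suc n} f≈0 = trans (+-cong (f≈0 zero) (sum≈0 (f≈0 ∘ suc))) (+-identityʳ 0#)

-- Expectations over finitely supported distributions.

module Expectation (ℝ : RealNumbers) where
  open RealNumbers ℝ hiding (zero)
  open Probability ℝ
  open OrderedField ℝ
  open FiniteSums ℝ
  open PartialOrderReasoning poset

  indicator : {P : Set} → Dec P → Carrier
  indicator P? = if does P? then 1# else 0#

  0≤indicator : {P : Set} (P? : Dec P) → 0# ≤ indicator P?
  0≤indicator (yes _) = 0≤1
  0≤indicator (no _)  = ≤-refl

  indicator-mono : {P Q : Set} (P? : Dec P) (Q? : Dec Q) → (P → Q) → indicator P? ≤ indicator Q?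
  indicator-mono (yes p) (yes q) _   = ≤-refl
  indicator-mono (yes p) (no ¬q) P⇒Q = contradiction (P⇒Q p) ¬q
  indicator-mono (no ¬p) Q?      _   = 0≤indicator Q?

  𝔼 : ∀ {A} → Dist A → (A → Carrier) → Carrier
  𝔼 []            φ = 0#
  𝔼 ((p , a) ∷ D) φ = p * φ a + 𝔼 D φ

  Pr≈𝔼 : ∀ {A} {P : Pred A 0ℓ} (D : Dist A) (P? : Decidable P) → Pr D P? ≈ 𝔼 D (indicator ∘ P?)
  Pr≈𝔼 []            P? = refl
  Pr≈𝔼 ((p , a) ∷ D) P? with P? a
  ... | yes _ = +-cong (sym (*-identityʳ p)) (Pr≈𝔼 D P?)
  ... | no _  = +-cong (sym (zeroʳ p)) (Pr≈𝔼 D P?)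

  𝔼-cong : ∀ {A} (D : Dist A) {φ ψ : A → Carrier} → (∀ a → φ a ≈ ψ a) → 𝔼 D φ ≈ 𝔼 D ψ
  𝔼-cong []            φ≈ψ = refl
  𝔼-cong ((p , a) ∷ D) φ≈ψ = +-cong (*-congˡ (φ≈ψ a)) (𝔼-cong D φ≈ψ)

  𝔼-+ : ∀ {A} (D : Dist A) (φ ψ : A → Carrier) → 𝔼 D (λ a → φ a + ψ a) ≈ 𝔼 D φ + 𝔼 D ψ
  𝔼-+ []            φ ψ = sym (+-identityʳ 0#)
  𝔼-+ ((p , a) ∷ D) φ ψ = begin-equality
    p * (φ a + ψ a) + 𝔼 D (λ a → φ a + ψ a)   ≈⟨ +-congˡ (𝔼-+ D φ ψ) ⟩
    p * (φ a + ψ a) + (𝔼 D φ + 𝔼 D ψ)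
      ≈⟨ solve 5 (λ p x y e f → p :* (x :+ y) :+ (e :+ f) := (p :* x :+ e) :+ (p :* y :+ f))
           refl p (φ a) (ψ a) (𝔼 D φ) (𝔼 D ψ) ⟩
    (p * φ a + 𝔼 D φ) + (p * ψ a + 𝔼 D ψ)     ∎

  𝔼-*ʳ : ∀ {A} (D : Dist A) (φ : A → Carrier) c → 𝔼 D (λ a → φ a * c) ≈ 𝔼 D φ * c
  𝔼-*ʳ []            φ c = sym (zeroˡ c)
  𝔼-*ʳ ((p , a) ∷ D) φ c = begin-equality
    p * (φ a * c) + 𝔼 D (λ a → φ a * c) ≈⟨ +-cong (sym (*-assoc p (φ a) c)) (𝔼-*ʳ D φ c) ⟩
    p * φ a * c + 𝔼 D φ * c             ≈⟨ distribʳ c (p * φ a) (𝔼 D φ) ⟨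
    (p * φ a + 𝔼 D φ) * c               ∎

  𝔼-++ : ∀ {A} (D D′ : Dist A) φ → 𝔼 (D ++ D′) φ ≈ 𝔼 D φ + 𝔼 D′ φ
  𝔼-++ []            D′ φ = sym (+-identityˡ (𝔼 D′ φ))
  𝔼-++ ((p , a) ∷ D) D′ φ = trans (+-congˡ (𝔼-++ D D′ φ)) (sym (+-assoc _ _ _))

  scale : ∀ {A : Set} → Carrier → Dist A → Dist A
  scale p = List.map λ (q , b) → p * q , b

  𝔼-scale : ∀ {A} p (D : Dist A) φ → 𝔼 (scale p D) φ ≈ p * 𝔼 D φ
  𝔼-scale p []            φ = sym (zeroʳ p)
  𝔼-scale p ((q , a) ∷ D) φ = begin-equality
    p * q * φ a + 𝔼 (scale p D) φ ≈⟨ +-cong (*-assoc p q (φ a)) (𝔼-scale p D φ) ⟩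
    p * (q * φ a) + p * 𝔼 D φ     ≈⟨ distribˡ p (q * φ a) (𝔼 D φ) ⟨
    p * (q * φ a + 𝔼 D φ)         ∎

  𝔼->>= : ∀ {A B} (D : Dist A) (f : A → Dist B) φ → 𝔼 (D >>= f) φ ≈ 𝔼 D (λ a → 𝔼 (f a) φ)
  𝔼->>= []            f φ = refl
  𝔼->>= ((p , a) ∷ D) f φ = begin-equality
    𝔼 (scale p (f a) ++ (D >>= f)) φ               ≈⟨ 𝔼-++ (scale p (f a)) (D >>= f) φ ⟩
    𝔼 (scale p (f a)) φ + 𝔼 (D >>= f) φ            ≈⟨ +-cong (𝔼-scale p (f a) φ) (𝔼->>= D f φ) ⟩
    p * 𝔼 (f a) φ + 𝔼 D (λ a → 𝔼 (f a) φ)          ∎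

  𝔼-return : ∀ {A} (a : A) φ → 𝔼 (return a) φ ≈ φ a
  𝔼-return a φ = trans (+-identityʳ (1# * φ a)) (*-identityˡ (φ a))

  𝔼-fmap : ∀ {A B} (D : Dist A) (f : A → B) φ → 𝔼 (D >>= (return ∘ f)) φ ≈ 𝔼 D (φ ∘ f)
  𝔼-fmap D f φ = trans (𝔼->>= D (return ∘ f) φ) (𝔼-cong D λ a → 𝔼-return (f a) φ)

  𝔼-fromPMF : ∀ {d} (p : Fin d → Carrier) φ → 𝔼 (fromPMF p) φ ≈ sum (λ j → p j * φ j)
  𝔼-fromPMF p φ = 𝔼-tabulate id
    where
    𝔼-tabulate : ∀ {n} (g : Fin n → _) →
                 𝔼 (List.map (λ j → p j , j) (tabulate g)) φ ≈ sum (λ i → p (g i) * φ (g i))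
    𝔼-tabulate {zero}  g = refl
    𝔼-tabulate {suc n} g = +-congˡ (𝔼-tabulate (g ∘ suc))

  -- `Q` is required at every listed outcome, those of weight zero included. Its role is to carry
  -- the length of a history through a run; laws coming from `fromPMF` list all of `Fin d` and only
  -- get `Always`.
  record IsDistributionOn {A : Set} (Q : Pred A 0ℓ) (D : Dist A) : Set where
    constructor isDistributionOn
    field
      support : All (λ (p , a) → 0# ≤ p × Q a) D
      mass    : 𝔼 D (const 1#) ≈ 1#

  open IsDistributionOn

  𝔼-mono-≤ : ∀ {A} {Q : Pred A 0ℓ} {D} {φ ψ : A → Carrier} → IsDistributionOn Q D →
             (∀ a → Q a → φ a ≤ ψ a) → 𝔼 D φ ≤ 𝔼 D ψ
  𝔼-mono-≤ {Q = Q} {φ = φ} {ψ} isD φ≤ψ = go (isD .support)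
    where
    go : ∀ {D} → All (λ (p , a) → 0# ≤ p × Q a) D → 𝔼 D φ ≤ 𝔼 D ψ
    go []                 = ≤-refl
    go ((0≤p , Qa) ∷ sup) = +-mono-≤ (*-monoʳ-≤ 0≤p (φ≤ψ _ Qa)) (go sup)

  0≤𝔼 : ∀ {A} {Q : Pred A 0ℓ} {D} {φ : A → Carrier} → IsDistributionOn Q D →
        (∀ a → Q a → 0# ≤ φ a) → 0# ≤ 𝔼 D φ
  0≤𝔼 {Q = Q} {φ = φ} isD 0≤φ = go (isD .support)
    where
    go : ∀ {D} → All (λ (p , a) → 0# ≤ p × Q a) D → 0# ≤ 𝔼 D φ
    go []                 = ≤-refl
    go ((0≤p , Qa) ∷ sup) = 0≤+ (*-nonNeg 0≤p (0≤φ _ Qa)) (go sup)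

  return-isDistribution : ∀ {A} {Q : Pred A 0ℓ} {a} → Q a → IsDistributionOn Q (return a)
  return-isDistribution {a = a} Qa =
    isDistributionOn ((0≤1 , Qa) ∷ []) (𝔼-return a (const 1#))

  >>=-isDistribution : ∀ {A B} {P : Pred A 0ℓ} {Q : Pred B 0ℓ} {D} {f : A → Dist B} →
                       IsDistributionOn P D → (∀ a → P a → IsDistributionOn Q (f a)) →
                       IsDistributionOn Q (D >>= f)
  >>=-isDistribution {P = P} {Q} {D} {f} isD isf =
    isDistributionOn (go (isD .support)) $ begin-equality
      𝔼 (D >>= f) (const 1#)              ≈⟨ 𝔼->>= D f (const 1#) ⟩
      𝔼 D (λ a → 𝔼 (f a) (const 1#))
        -- `𝔼-cong` would ask for equality at all outcomes, but the inner mass is known to be 1 only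
        -- where `P` holds.
        ≈⟨ ≤-antisym (𝔼-mono-≤ isD λ a Pa → ≤-reflexive (isf a Pa .mass))
                     (𝔼-mono-≤ isD λ a Pa → ≤-reflexive (sym (isf a Pa .mass))) ⟩
      𝔼 D (const 1#)                      ≈⟨ isD .mass ⟩
      1#                                  ∎
    where
    go : ∀ {D} → All (λ (p , a) → 0# ≤ p × P a) D → All (λ (p , a) → 0# ≤ p × Q a) (D >>= f)
    go []                 = []
    go ((0≤p , Pa) ∷ sup) = All.++⁺
      (All.map⁺ (All.map (λ (0≤q , Qb) → *-nonNeg 0≤p 0≤q , Qb) (isf _ Pa .support)))
      (go sup)

  fromPMF-isDistribution : ∀ {d} {A : Subset d} {p} → IsPMFOn A p →
                           IsDistributionOn Always (fromPMF p)
  fromPMF-isDistribution {d} {p = p} pmf = isDistributionOn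
    (All.map⁺ (All.universal (λ j → nonNeg j , tt) (allFin d)))
    (begin-equality
      𝔼 (fromPMF p) (const 1#)  ≈⟨ 𝔼-fromPMF p (const 1#) ⟩
      sum (λ j → p j * 1#)      ≈⟨ sum-cong-≋ (λ j → *-identityʳ (p j)) ⟩
      sum p                     ≈⟨ total ⟩
      1#                        ∎)
    where open IsPMFOn pmf

  independently-isDistribution : ∀ {A} {D : ℕ → Dist A} → (∀ t → IsDistributionOn Always (D t)) →
                                 ∀ n → IsDistributionOn Always (independently D n)
  independently-isDistribution isD zero    = return-isDistribution tt
  independently-isDistribution isD (suc n) =
    >>=-isDistribution (isD n) λ _ _ →
    >>=-isDistribution (independently-isDistribution isD n) λ _ _ →
    return-isDistribution tt

  ∏[_] : ∀ {A : Set} → (A → Carrier) → List A → Carrier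
  ∏[ φ ] []       = 1#
  ∏[ φ ] (a ∷ as) = φ a * ∏[ φ ] as

  0≤∏ : ∀ {A : Set} {φ : A → Carrier} → (∀ a → 0# ≤ φ a) → ∀ as → 0# ≤ ∏[ φ ] as
  0≤∏ 0≤φ []       = 0≤1
  0≤∏ 0≤φ (a ∷ as) = *-nonNeg (0≤φ a) (0≤∏ 0≤φ as)

  ∏≈1 : ∀ {A : Set} {φ : A → Carrier} {as} → All (λ a → φ a ≈ 1#) as → ∏[ φ ] as ≈ 1#
  ∏≈1 []              = refl
  ∏≈1 (φa≈1 ∷ φas≈1) = trans (*-cong φa≈1 (∏≈1 φas≈1)) (*-identityʳ 1#)

  -- By independence the expectation of the product factors over the runs. The factors may differ,
  -- since each run has its own law `D t`, so they are compared with a common bound `u`.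
  𝔼-∏-independently : ∀ {A} {D : ℕ → Dist A} {φ : A → Carrier} {u} →
                      (∀ t → IsDistributionOn Always (D t)) → (∀ a → 0# ≤ φ a) →
                      (∀ t → 𝔼 (D t) φ ≤ u) → 0# ≤ u →
                      ∀ n → 𝔼 (independently D n) ∏[ φ ] ≤ u ^ n
  𝔼-∏-independently {D = D} {φ} {u} isD 0≤φ 𝔼φ≤u 0≤u zero    = ≤-reflexive (𝔼-return [] ∏[ φ ])
  𝔼-∏-independently {D = D} {φ} {u} isD 0≤φ 𝔼φ≤u 0≤u (suc n) = begin
    𝔼 (independently D (suc n)) ∏[ φ ]  ≈⟨ 𝔼->>= (D n) _ ∏[ φ ] ⟩
    𝔼 (D n) (λ a → 𝔼 (Ds >>= λ as → return (a ∷ as)) ∏[ φ ])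
      ≈⟨ 𝔼-cong (D n) (λ a → begin-equality
      𝔼 (Ds >>= λ as → return (a ∷ as)) ∏[ φ ] ≈⟨ 𝔼-fmap Ds (a ∷_) ∏[ φ ] ⟩
      𝔼 Ds (λ as → φ a * ∏[ φ ] as)     ≈⟨ 𝔼-cong Ds (λ as → *-comm (φ a) (∏[ φ ] as)) ⟩
      𝔼 Ds (λ as → ∏[ φ ] as * φ a)     ≈⟨ 𝔼-*ʳ Ds ∏[ φ ] (φ a) ⟩
      𝔼 Ds ∏[ φ ] * φ a                 ≈⟨ *-comm (𝔼 Ds ∏[ φ ]) (φ a) ⟩
      φ a * 𝔼 Ds ∏[ φ ]                 ∎) ⟩
    𝔼 (D n) (λ a → φ a * 𝔼 Ds ∏[ φ ])   ≈⟨ 𝔼-*ʳ (D n) φ (𝔼 Ds ∏[ φ ]) ⟩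
    𝔼 (D n) φ * 𝔼 Ds ∏[ φ ]
      ≤⟨ *-mono-≤ (0≤𝔼 (independently-isDistribution isD n) λ as _ → 0≤∏ 0≤φ as) 0≤u
                  (𝔼φ≤u n) (𝔼-∏-independently isD 0≤φ 𝔼φ≤u 0≤u n) ⟩
    u * u ^ n                           ∎
    where Ds = independently D n

-- Cardinalities of subsets while an element is added.

∣p∪⁅x⁆∣≤1+∣p∣ : ∀ {n} (p : Subset n) x → ∣ p ∪ ⁅ x ⁆ ∣ ℕ.≤ suc ∣ p ∣
∣p∪⁅x⁆∣≤1+∣p∣ (inside  ∷ p) zero    rewrite ∪-identityʳ p = ℕₚ.n≤1+n _
∣p∪⁅x⁆∣≤1+∣p∣ (outside ∷ p) zero    rewrite ∪-identityʳ p = ℕₚ.≤-refl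
∣p∪⁅x⁆∣≤1+∣p∣ (inside  ∷ p) (suc x) = ℕ.s≤s (∣p∪⁅x⁆∣≤1+∣p∣ p x)
∣p∪⁅x⁆∣≤1+∣p∣ (outside ∷ p) (suc x) = ∣p∪⁅x⁆∣≤1+∣p∣ p x

∣p∣<n⇒Nonempty-∁ : ∀ {n} (p : Subset n) → ∣ p ∣ ℕ.< n → Nonempty (∁ p)
∣p∣<n⇒Nonempty-∁ {n} p ∣p∣<n with nonempty? (∁ p)
... | yes ∁p≢∅ = ∁p≢∅
... | no  ∁p≡∅ = contradiction ∣p∣<n (ℕₚ.≤⇒≯ (ℕₚ.m∸n≡0⇒m≤n (≡.trans (≡.sym (∣∁p∣≡n∸∣p∣ p))
                   (≡.trans (≡.cong ∣_∣ (Empty-unique ∁p≡∅)) (∣⊥∣≡0 n)))))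

-- The element `x` itself witnesses strictness. With p = S* this measures progress: choosing a
-- missing element of S* lowers the number of missing ones.
x∈p∩∁q⇒p∩∁[q∪⁅x⁆]⊂p∩∁q : ∀ {n} (p q : Subset n) {x} → x ∈ p ∩ ∁ q → p ∩ ∁ (q ∪ ⁅ x ⁆) ⊂ p ∩ ∁ q
x∈p∩∁q⇒p∩∁[q∪⁅x⁆]⊂p∩∁q p q {x} x∈p∩∁q =
  (λ y∈ → let y∈p , y∈∁ = x∈p∩q⁻ p (∁ (q ∪ ⁅ x ⁆)) y∈ in
          x∈p∩q⁺ (y∈p , p⊆q⇒∁p⊇∁q (p⊆p∪q ⁅ x ⁆) y∈∁)) ,
  x , x∈p∩∁q ,
  λ x∈ → x∈∁p⇒x∉p (proj₂ (x∈p∩q⁻ p (∁ (q ∪ ⁅ x ⁆)) x∈)) (q⊆p∪q q ⁅ x ⁆ (x∈⁅x⁆ x))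

p∩∁q-empty⇒p⊆q : ∀ {n} (p q : Subset n) → ∣ p ∩ ∁ q ∣ ℕ.≤ 0 → p ⊆ q
p∩∁q-empty⇒p⊆q p q ∣p∩∁q∣≤0 {x} x∈p with x ∈? q
... | yes x∈q = x∈q
... | no  x∉q = contradiction
  (ℕₚ.<-≤-trans (p⊂q⇒∣p∣<∣q∣ (x∈p∩∁q⇒p∩∁[q∪⁅x⁆]⊂p∩∁q p q (x∈p∩q⁺ (x∈p , x∉p⇒x∈∁p x∉q)))) ∣p∩∁q∣≤0)
  λ ()

-- Marginal gains and the ratios of a monotone set function.

module Greedy (ℝ : RealNumbers) {d : ℕ} (F : Subset d → RealNumbers.Carrier ℝ)
              (monotone : SetFunction.Monotone ℝ F) where
  open RealNumbers ℝ hiding (zero)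
  open Probability ℝ
  open SetFunction ℝ F
  open OrderedField ℝ
  open FiniteSums ℝ
  open Expectation ℝ
  open PartialOrderReasoning poset

  F-mono-≤ : ∀ {S T} → S ⊆ T → F S ≤ F T
  F-mono-≤ {S} {T} S⊆T = ≡.subst (λ U → F S ≤ F U) S∪T≡T (0≤y-x⇒x≤y (monotone S T))
    where
    S∪T≡T : S ∪ T ≡ T
    S∪T≡T = ⊆-antisym (λ x∈ → [ S⊆T , id ]′ (x∈p∪q⁻ S T x∈)) (q⊆p∪q S T)

  0≤f : ∀ S j → 0# ≤ f⟨ j ∣ S ⟩
  0≤f S j = monotone S ⁅ j ⁆

  restrict : Subset d → (Fin d → Carrier) → Fin d → Carrier
  restrict T g j = if does (j ∈? T) then g j else 0#

  restrict-∈ : ∀ {T} g {j} → j ∈ T → restrict T g j ≡ g j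
  restrict-∈ {T} g {j} j∈T = ≡.cong (if_then g j else 0#) (dec-true (j ∈? T) j∈T)

  restrict-∉ : ∀ {T} g {j} → j ∉ T → restrict T g j ≡ 0#
  restrict-∉ {T} g {j} j∉T = ≡.cong (if_then g j else 0#) (dec-false (j ∈? T) j∉T)

  0≤restrict : ∀ T {g} → (∀ j → 0# ≤ g j) → ∀ j → 0# ≤ restrict T g j
  0≤restrict T 0≤g j with j ∈? T
  ... | yes _ = 0≤g j
  ... | no _  = ≤-refl

  0≤∑f : ∀ S T → 0# ≤ ∑[ T ] (λ j → f⟨ j ∣ S ⟩)
  0≤∑f S T = 0≤sum (0≤restrict T (0≤f S))

  AdmissiblePair : Subset d → ℕ → Pred (Subset d × Subset d) 0ℓ
  AdmissiblePair U s (L , T) = Empty (L ∩ T) × L ⊆ U × ∣ T ∣ ℕ.≤ s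

  jointGain summedGains : Subset d × Subset d → Carrier
  jointGain   (L , T) = F⟨ T ∣ L ⟩
  summedGains (L , T) = ∑[ T ] (λ j → f⟨ j ∣ L ⟩)

  -- A minimum over existing ratios constrains `U` only if `U` has a ratio. Existence is what allows
  -- `γ-bound` to compare the minimum with the ratio at a chosen set.
  submodularityRatio : ∀ U s → Satisfiable (IsSubmodularityRatio U s)
  submodularityRatio U s = proj₁ ratio ,
    IsMaximum-⇔ {Scalar} {SubmodularityBound U s} (proj₂ ratio)
    (λ x (0≤x , x≤1 , bound) → 0≤x , x≤1 , λ L T L∩T≡∅ L⊆U ∣T∣≤s →
      bound (L , T) (L∩T≡∅ , L⊆U , ∣T∣≤s))
    (λ x (0≤x , x≤1 , bound) → 0≤x , x≤1 , λ (L , T) (L∩T≡∅ , L⊆U , ∣T∣≤s) →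
      bound L T L∩T≡∅ L⊆U ∣T∣≤s)
    where
    Scalar : Pred Carrier 0ℓ
    Scalar = Admissible (AdmissiblePair U s) jointGain summedGains

    ratio : Satisfiable (IsMaximum Scalar)
    ratio = largestScalar (AdmissiblePair U s) jointGain summedGains
      (λ (L , T) _ → monotone L T) (λ (L , T) _ → 0≤∑f L T)

  -- Clearing the inverse agrees with the convention at β = 0: there the bound is void, and the
  -- product form reduces to 0 ≤ b.
  β-bound-* : ∀ {β a b} → 0# ≤ β → 0# ≤ b → (0# < β → a ≤ β ⁻¹ * b) → β * a ≤ b
  β-bound-* {β} {a} {b} 0≤β 0≤b bound with β ≟ 0#
  ... | yes β≈0 = begin
    β * a  ≈⟨ *-congʳ β≈0 ⟩
    0# * a ≈⟨ zeroˡ a ⟩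
    0#     ≤⟨ 0≤b ⟩
    b      ∎
  ... | no β≉0 = begin
    β * a          ≤⟨ *-monoʳ-≤ 0≤β (bound 0<β) ⟩
    β * (β ⁻¹ * b) ≈⟨ *-assoc β (β ⁻¹) b ⟨
    β * β ⁻¹ * b   ≈⟨ *-congʳ (⁻¹-inverseʳ β≉0) ⟩
    1# * b         ≈⟨ *-identityˡ b ⟩
    b              ∎
    where
    0<β : 0# < β
    0<β = 0≤β , β≉0 ∘ sym

  supermodularityRatio : ∀ U s → Satisfiable (IsSupermodularityRatio U s)
  supermodularityRatio U s = proj₁ ratio ,
    IsMaximum-⇔ {Scalar} {SupermodularityBound U s} (proj₂ ratio)
    (λ x (0≤x , x≤1 , bound) → 0≤x , x≤1 , λ L T L∩T≡∅ L⊆U ∣T∣≤s 0<x →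
      ≤-respʳ-≈ (*-comm _ _) $ x*z≤y⇒x≤y/z 0<x $ ≤-respˡ-≈ (*-comm _ _) $
      bound (L , T) (L∩T≡∅ , L⊆U , ∣T∣≤s))
    (λ x (0≤x , x≤1 , bound) → 0≤x , x≤1 , λ (L , T) (L∩T≡∅ , L⊆U , ∣T∣≤s) →
      β-bound-* 0≤x (monotone L T) (bound L T L∩T≡∅ L⊆U ∣T∣≤s))
    where
    Scalar : Pred Carrier 0ℓ
    Scalar = Admissible (AdmissiblePair U s) summedGains jointGain

    ratio : Satisfiable (IsMaximum Scalar)
    ratio = largestScalar (AdmissiblePair U s) summedGains jointGain
      (λ (L , T) _ → 0≤∑f L T) (λ (L , T) _ → monotone L T)

  γ-bound : ∀ {s′ s γ} → IsMinSubmodularityRatio s′ s γ → ∀ U → ∣ U ∣ ℕ.≤ s′ →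
            ForAdmissible U s (λ L T → γ * F⟨ T ∣ L ⟩ ≤ ∑[ T ] (λ j → f⟨ j ∣ L ⟩))
  γ-bound {s = s} {γ} (_ , γ-min) U ∣U∣≤s′ L T L∩T≡∅ L⊆U ∣T∣≤s =
    let γU , isγU = submodularityRatio U s
        (_ , _ , bound) , _ = isγU
    in ≤-trans (*-monoˡ-≤ (monotone L T) (γ-min γU (U , ∣U∣≤s′ , isγU))) (bound L T L∩T≡∅ L⊆U ∣T∣≤s)

  -- With β as a factor on the smaller side, passing from the minimum to the ratio of `U` is
  -- monotonicity of a product, and no inverses have to be compared.
  β-bound : ∀ {s′ s β} → IsMinSupermodularityRatio s′ s β → ∀ U → ∣ U ∣ ℕ.≤ s′ →
            ForAdmissible U s (λ L T → β * ∑[ T ] (λ j → f⟨ j ∣ L ⟩) ≤ F⟨ T ∣ L ⟩)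
  β-bound {s = s} {β} (_ , β-min) U ∣U∣≤s′ L T L∩T≡∅ L⊆U ∣T∣≤s =
    let βU , isβU = supermodularityRatio U s
        (0≤βU , _ , bound) , _ = isβU
    in ≤-trans (*-monoˡ-≤ (0≤∑f L T) (β-min βU (U , ∣U∣≤s′ , isβU)))
         (β-bound-* 0≤βU (monotone L T) (bound L T L∩T≡∅ L⊆U ∣T∣≤s))

  totalGain : Subset d → Carrier
  totalGain S = ∑[ ∁ S ] (λ j → f⟨ j ∣ S ⟩)

  -- In this form the normalizing factor can be pulled out of sums over all of `Fin d`.
  proportional≈ : ∀ S j → proportional S j ≈ restrict (∁ S) (λ i → f⟨ i ∣ S ⟩) j * totalGain S ⁻¹
  proportional≈ S j with j ∈? S | j ∈? ∁ S
  ... | yes j∈S | yes j∈∁S = contradiction j∈S (x∈∁p⇒x∉p j∈∁S)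
  ... | yes _   | no _     = sym (zeroˡ _)
  ... | no _    | yes _    = refl
  ... | no j∉S  | no j∉∁S  = contradiction (x∉∁p⇒x∈p j∉∁S) j∉S

  Stuck : Pred (Subset d) 0ℓ
  Stuck S = ∀ j → j ∉ S → f⟨ j ∣ S ⟩ ≈ 0#

  stuck⇒totalGain≈0 : ∀ {S} → Stuck S → totalGain S ≈ 0#
  stuck⇒totalGain≈0 {S} stuck = sum≈0 λ j → helper j
    where
    helper : ∀ j → restrict (∁ S) (λ i → f⟨ i ∣ S ⟩) j ≈ 0#
    helper j with j ∈? ∁ S
    ... | yes j∈∁S = stuck j (x∈∁p⇒x∉p j∈∁S)
    ... | no _     = refl

  ¬stuck⇒0<totalGain : ∀ {S} → ¬ Stuck S → 0# < totalGain S
  ¬stuck⇒0<totalGain {S} ¬stuck = 0≤∑f S (∁ S) , λ 0≈gain → ¬stuck λ j j∉S →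
    ≤-antisym
      (begin
        f⟨ j ∣ S ⟩
          ≡⟨ restrict-∈ (λ i → f⟨ i ∣ S ⟩) (x∉p⇒x∈∁p j∉S) ⟨
        restrict (∁ S) (λ i → f⟨ i ∣ S ⟩) j       ≤⟨ term≤sum (0≤restrict (∁ S) (0≤f S)) j ⟩
        totalGain S                               ≈⟨ 0≈gain ⟨
        0#                                        ∎)
      (0≤f S j)

  proportional-isPMF : ∀ {S} → 0# < totalGain S → IsPMFOn (∁ S) (proportional S)
  proportional-isPMF {S} 0<gain = record
    { nonNeg = λ j → ≤-respʳ-≈ (sym (proportional≈ S j))
        (*-nonNeg (0≤restrict (∁ S) (0≤f S) j) (<⇒≤ (0<⁻¹ 0<gain)))
    ; off    = λ j j∉∁S → trans (proportional≈ S j)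
        (trans (*-congʳ (reflexive (restrict-∉ (λ i → f⟨ i ∣ S ⟩) j∉∁S))) (zeroˡ _))
    ; total  = begin-equality
        sum (proportional S)                     ≈⟨ sum-cong-≋ (proportional≈ S) ⟩
        sum (λ j → restrict (∁ S) (λ i → f⟨ i ∣ S ⟩) j * totalGain S ⁻¹)
          ≈⟨ *-distribʳ-sum (totalGain S ⁻¹) (restrict (∁ S) (λ i → f⟨ i ∣ S ⟩)) ⟨
        totalGain S * totalGain S ⁻¹             ≈⟨ ⁻¹-inverseʳ (pos⇒≉0 0<gain) ⟩
        1#                                       ∎
    }

  -- The law of a single run.

  ∣selected∣≤length : ∀ h → ∣ selected h ∣ ℕ.≤ length h
  ∣selected∣≤length []      = ℕₚ.≤-reflexive (∣⊥∣≡0 d)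
  ∣selected∣≤length (j ∷ h) =
    ℕₚ.≤-trans (∣p∪⁅x⁆∣≤1+∣p∣ (selected h) j) (ℕ.s≤s (∣selected∣≤length h))

  module _ (arb : Fallback) (valid : ValidFallback arb) where

    -- The decision is an argument so that proofs can match on it; at `stuck? (selected h)` this is
    -- by definition the weight function used by `choose`.
    law : ∀ h → Dec (Stuck (selected h)) → Fin d → Carrier
    law h isStuck? = if does isStuck? then arb h else proportional (selected h)

    choose-isDistribution : ∀ h → length h ℕ.< d → IsDistributionOn Always (choose arb h)
    choose-isDistribution h ∣h∣<d = fromPMF-isDistribution (law-isPMF (stuck? (selected h)))
      where
      law-isPMF : ∀ isStuck? → IsPMFOn (∁ (selected h)) (law h isStuck?)
      law-isPMF (yes _)     = valid h (∣p∣<n⇒Nonempty-∁ (selected h)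
        (ℕₚ.≤-<-trans (∣selected∣≤length h) ∣h∣<d))
      law-isPMF (no ¬stuck) = proportional-isPMF (¬stuck⇒0<totalGain ¬stuck)

    runHistory-isDistribution : ∀ i → i ℕ.≤ d →
      IsDistributionOn (λ h → length h ≡ i) (runHistory arb i)
    runHistory-isDistribution zero    _   = return-isDistribution ≡.refl
    runHistory-isDistribution (suc i) i<d =
      >>=-isDistribution (runHistory-isDistribution i (ℕₚ.<⇒≤ i<d)) λ h ∣h∣≡i →
      >>=-isDistribution (choose-isDistribution h (≡.subst (ℕ._< d) (≡.sym ∣h∣≡i) i<d)) λ _ _ →
      return-isDistribution (≡.cong suc ∣h∣≡i)

    singleRun-isDistribution : ∀ k → k ℕ.≤ d → IsDistributionOn Always (singleRun arb k)
    singleRun-isDistribution k k≤d =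
      >>=-isDistribution (runHistory-isDistribution k k≤d) λ _ _ → return-isDistribution tt

    -- Positive total gain rules out the fallback, and the proportional rule then hits `T` with
    -- probability equal to the gains in `T` divided by the total gain.
    choose-∈ : ∀ {q} h T → T ⊆ ∁ (selected h) → let S = selected h in
               0# < totalGain S → q * totalGain S ≤ ∑[ T ] (λ j → f⟨ j ∣ S ⟩) →
               q ≤ 𝔼 (choose arb h) (λ j → indicator (j ∈? T))
    choose-∈ {q} h T T⊆∁S 0<gain q*gain≤ = law-∈ (stuck? S)
      where
      S : Subset d
      S = selected h

      gain : Fin d → Carrier
      gain j = f⟨ j ∣ S ⟩

      pointwise : ∀ j → restrict T gain j * totalGain S ⁻¹ ≈ proportional S j * indicator (j ∈? T)
      pointwise j with j ∈? T
      ... | no _    = trans (zeroˡ _) (sym (zeroʳ _))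
      ... | yes j∈T = begin-equality
        gain j * totalGain S ⁻¹
          ≡⟨ ≡.cong (_* totalGain S ⁻¹) (restrict-∈ gain (T⊆∁S j∈T)) ⟨
        restrict (∁ S) gain j * totalGain S ⁻¹ ≈⟨ proportional≈ S j ⟨
        proportional S j                       ≈⟨ *-identityʳ _ ⟨
        proportional S j * 1#                  ∎

      law-∈ : ∀ isStuck? → q ≤ 𝔼 (fromPMF (law h isStuck?)) (λ j → indicator (j ∈? T))
      law-∈ (yes stuck) = contradiction (stuck⇒totalGain≈0 stuck) (pos⇒≉0 0<gain)
      law-∈ (no _)      = begin
        q                                                 ≤⟨ x*z≤y⇒x≤y/z 0<gain q*gain≤ ⟩
        ∑[ T ] gain * totalGain S ⁻¹
          ≈⟨ *-distribʳ-sum (totalGain S ⁻¹) (restrict T gain) ⟩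
        sum (λ j → restrict T gain j * totalGain S ⁻¹)    ≈⟨ sum-cong-≋ pointwise ⟩
        sum (λ j → proportional S j * indicator (j ∈? T)) ≈⟨ 𝔼-fromPMF (proportional S) _ ⟨
        𝔼 (fromPMF (proportional S)) (λ j → indicator (j ∈? T)) ∎

  -- Success probability of a single run, given the one-step bound `q-step`.

  module Success (S* : Subset d) (threshold q : Carrier) (k : ℕ) (k≤d : k ℕ.≤ d)
    (S*-succeeds : threshold ≤ F S*) (∣S*∣≤k : ∣ S* ∣ ℕ.≤ k) (0≤q : 0# ≤ q) (q≤1 : q ≤ 1#)
    (q-step : ∀ S → ∣ S ∣ ℕ.≤ k → F S < threshold →
              0# < totalGain S × q * totalGain S ≤ ∑[ S* ∩ ∁ S ] (λ j → f⟨ j ∣ S ⟩))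
    where

    success? : Decidable (λ S → threshold ≤ F S)
    success? S = threshold ≤? F S

    -- After k steps the second alternative leaves no element of S* unselected.
    OnTrack : Pred History 0ℓ
    OnTrack h = threshold ≤ F (selected h) ⊎ ∣ S* ∩ ∁ (selected h) ∣ ℕ.+ length h ℕ.≤ k

    onTrack? : Decidable OnTrack
    onTrack? h = success? (selected h) ⊎-dec (_ ℕₚ.≤? k)

    onTrack-[] : OnTrack []
    onTrack-[] = inj₂ (≡.subst (ℕ._≤ k) (≡.sym (ℕₚ.+-identityʳ _))
      (ℕₚ.≤-trans (∣p∩q∣≤∣p∣ S* _) ∣S*∣≤k))

    -- A reached threshold persists by monotonicity. Otherwise the chosen element of S* lowers the
    -- missing count by at least the one that the length gains, so their sum stays within `k`.
    onTrack-∷ : ∀ h j → OnTrack h →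
                threshold ≤ F (selected h) ⊎ j ∈ S* ∩ ∁ (selected h) → OnTrack (j ∷ h)
    onTrack-∷ h j (inj₁ good)  _           = inj₁ (≤-trans good (F-mono-≤ (p⊆p∪q ⁅ j ⁆)))
    onTrack-∷ h j (inj₂ _)     (inj₁ good) = inj₁ (≤-trans good (F-mono-≤ (p⊆p∪q ⁅ j ⁆)))
    onTrack-∷ h j (inj₂ bound) (inj₂ j∈)   = inj₂ $
      ℕₚ.≤-trans (ℕₚ.≤-reflexive (ℕₚ.+-suc _ (length h))) $
      ℕₚ.≤-trans (ℕₚ.+-monoˡ-≤ (length h)
        (p⊂q⇒∣p∣<∣q∣ (x∈p∩∁q⇒p∩∁[q∪⁅x⁆]⊂p∩∁q S* (selected h) j∈))) bound

    onTrack⇒success : ∀ h → length h ≡ k → OnTrack h → threshold ≤ F (selected h)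
    onTrack⇒success h ∣h∣≡k (inj₁ good)  = good
    onTrack⇒success h ∣h∣≡k (inj₂ bound) = ≤-trans S*-succeeds $ F-mono-≤ $
      p∩∁q-empty⇒p⊆q S* (selected h) $ ℕₚ.+-cancelʳ-≤ k _ 0 $
      ≡.subst (λ i → ∣ S* ∩ ∁ (selected h) ∣ ℕ.+ i ℕ.≤ k) ∣h∣≡k bound

    module _ (arb : Fallback) (valid : ValidFallback arb) where

      -- The indicator factor makes the bound trivial off track, so it holds for every history of
      -- admissible length and can be averaged over all of them.
      step : ∀ h → length h ℕ.< k →
             indicator (onTrack? h) * q ≤ 𝔼 (choose arb h) (λ j → indicator (onTrack? (j ∷ h)))
      step h ∣h∣<k = byCases (onTrack? h) (success? S)
        where
        S : Subset d
        S = selected h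

        isD : IsDistributionOn Always (choose arb h)
        isD = choose-isDistribution arb valid h (ℕₚ.<-≤-trans ∣h∣<k k≤d)

        byCases : (onTrack : Dec (OnTrack h)) → Dec (threshold ≤ F S) →
                  indicator onTrack * q ≤ 𝔼 (choose arb h) (λ j → indicator (onTrack? (j ∷ h)))
        byCases (no _) _ = begin
          0# * q ≈⟨ zeroˡ q ⟩
          0#     ≤⟨ 0≤𝔼 isD (λ j _ → 0≤indicator (onTrack? (j ∷ h))) ⟩
          _      ∎
        -- Once the threshold is reached every choice stays on track, the arbitrary ones of a stuck
        -- run included; q ≤ 1 is all that is needed.
        byCases (yes onTrack) (yes good) = begin
          1# * q                              ≈⟨ *-identityˡ q ⟩
          q                                   ≤⟨ q≤1 ⟩
          1#                                  ≈⟨ IsDistributionOn.mass isD ⟨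
          𝔼 (choose arb h) (const 1#)
            ≤⟨ 𝔼-mono-≤ isD (λ j _ → indicator-mono (yes tt) (onTrack? (j ∷ h))
                              λ _ → onTrack-∷ h j onTrack (inj₁ good)) ⟩
          𝔼 (choose arb h) (λ j → indicator (onTrack? (j ∷ h))) ∎
        byCases (yes onTrack) (no bad) = begin
          1# * q ≈⟨ *-identityˡ q ⟩
          q      ≤⟨ choose-∈ arb valid h (S* ∩ ∁ S) (p∩q⊆q S* (∁ S)) 0<gain q*gain≤ ⟩
          𝔼 (choose arb h) (λ j → indicator (j ∈? S* ∩ ∁ S))
            ≤⟨ 𝔼-mono-≤ isD (λ j _ → indicator-mono (j ∈? S* ∩ ∁ S) (onTrack? (j ∷ h))
                              λ j∈ → onTrack-∷ h j onTrack (inj₂ j∈)) ⟩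
          𝔼 (choose arb h) (λ j → indicator (onTrack? (j ∷ h))) ∎
          where
          gain = q-step S (ℕₚ.≤-trans (∣selected∣≤length h) (ℕₚ.<⇒≤ ∣h∣<k)) (≰⇒> bad)
          0<gain  = proj₁ gain
          q*gain≤ = proj₂ gain

      q^i≤onTrack : ∀ i → i ℕ.≤ k → q ^ i ≤ 𝔼 (runHistory arb i) (indicator ∘ onTrack?)
      q^i≤onTrack zero    _   = begin
        1#
          ≤⟨ indicator-mono (yes tt) (onTrack? []) (λ _ → onTrack-[]) ⟩
        indicator (onTrack? [])     ≈⟨ 𝔼-return [] (indicator ∘ onTrack?) ⟨
        𝔼 (return []) (indicator ∘ onTrack?) ∎
      q^i≤onTrack (suc i) i<k = begin
        q * q ^ i                                            ≈⟨ *-comm q (q ^ i) ⟩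
        q ^ i * q
          ≤⟨ *-monoˡ-≤ 0≤q (q^i≤onTrack i (ℕₚ.<⇒≤ i<k)) ⟩
        𝔼 H (indicator ∘ onTrack?) * q
          ≈⟨ 𝔼-*ʳ H (indicator ∘ onTrack?) q ⟨
        𝔼 H (λ h → indicator (onTrack? h) * q)
          ≤⟨ 𝔼-mono-≤ (runHistory-isDistribution arb valid i (ℕₚ.≤-trans (ℕₚ.<⇒≤ i<k) k≤d))
                      (λ h ∣h∣≡i → step h (≡.subst (ℕ._< k) (≡.sym ∣h∣≡i) i<k)) ⟩
        𝔼 H (λ h → 𝔼 (choose arb h) (λ j → indicator (onTrack? (j ∷ h))))
          ≈⟨ 𝔼-cong H (λ h → 𝔼-fmap (choose arb h) (_∷ h) (indicator ∘ onTrack?)) ⟨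
        𝔼 H (λ h → 𝔼 (choose arb h >>= λ j → return (j ∷ h)) (indicator ∘ onTrack?))
          ≈⟨ 𝔼->>= H _ (indicator ∘ onTrack?) ⟨
        𝔼 (runHistory arb (suc i)) (indicator ∘ onTrack?)    ∎
        where H = runHistory arb i

      q^k≤success : q ^ k ≤ 𝔼 (singleRun arb k) (indicator ∘ success?)
      q^k≤success = begin
        q ^ k                                                   ≤⟨ q^i≤onTrack k ℕₚ.≤-refl ⟩
        𝔼 (runHistory arb k) (indicator ∘ onTrack?)
          ≤⟨ 𝔼-mono-≤ (runHistory-isDistribution arb valid k k≤d)
                      (λ h ∣h∣≡k → indicator-mono (onTrack? h) (success? (selected h))
                                     (onTrack⇒success h ∣h∣≡k)) ⟩
        𝔼 (runHistory arb k) (indicator ∘ success? ∘ selected)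
          ≈⟨ 𝔼-fmap (runHistory arb k) selected (indicator ∘ success?) ⟨
        𝔼 (singleRun arb k) (indicator ∘ success?)              ∎

      failure≤1-q^k : 𝔼 (singleRun arb k) (indicator ∘ ¬? ∘ success?) ≤ 1# - q ^ k
      failure≤1-q^k = +-cancelʳ-≤ (q ^ k) $ begin
        𝔼 D failure + q ^ k      ≤⟨ +-monoʳ-≤ _ q^k≤success ⟩
        𝔼 D failure + 𝔼 D (indicator ∘ success?) ≈⟨ 𝔼-+ D failure (indicator ∘ success?) ⟨
        𝔼 D (λ S → failure S + indicator (success? S))
          ≈⟨ 𝔼-cong D (λ S → complement (success? S)) ⟩
        𝔼 D (const 1#)
          ≈⟨ IsDistributionOn.mass (singleRun-isDistribution arb valid k k≤d) ⟩
        1#                       ≈⟨ //-rightDividesˡ (q ^ k) 1# ⟨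
        1# - q ^ k + q ^ k       ∎
        where
        D = singleRun arb k
        failure : Subset d → Carrier
        failure = indicator ∘ ¬? ∘ success?

        complement : {P : Set} (P? : Dec P) → indicator (¬? P?) + indicator P? ≈ 1#
        complement (yes _) = +-identityˡ 1#
        complement (no _)  = +-identityʳ 1#

    -- The best of several independent runs.

    F≤best : ∀ Ss → All (λ S → F S ≤ F (best Ss)) Ss
    F≤best []       = []
    F≤best (S ∷ Ss) = f[⊥]≤f[argmax] {f = F} S Ss ∷ f[xs]≤f[argmax] {f = F} S Ss
      where open Extrema totalOrder using (f[⊥]≤f[argmax]; f[xs]≤f[argmax])

    -- If the best solution misses the threshold, so do all of them, and the product of failure
    -- indicators is 1. For the empty list this product is 1 anyway, whatever value `best` takes
    -- there.
    1≤success+failures : ∀ Ss →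
      1# ≤ indicator (success? (best Ss)) + ∏[ indicator ∘ ¬? ∘ success? ] Ss
    1≤success+failures Ss with success? (best Ss)
    ... | yes _  = x≤x+y (0≤∏ (λ S → 0≤indicator (¬? (success? S))) Ss)
    ... | no bad = ≤-reflexive $ sym $ trans (+-identityˡ _) $ ∏≈1 $ All.map allFail (F≤best Ss)
      where
      allFail : ∀ {S} → F S ≤ F (best Ss) → indicator (¬? (success? S)) ≈ 1#
      allFail {S} FS≤ with success? S
      ... | yes good = contradiction (≤-trans good FS≤) bad
      ... | no _     = refl

    bestOfRuns-success : (arb : ℕ → Fallback) → (∀ t → ValidFallback (arb t)) → ∀ n →
      1# ≤ Pr (bestOfRuns arb k n) success? + (1# - q ^ k) ^ n
    bestOfRuns-success arb valid n = begin
      1#                                        ≈⟨ IsDistributionOn.mass isRuns ⟨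
      𝔼 runs (const 1#)
        ≤⟨ 𝔼-mono-≤ isRuns (λ Ss _ → 1≤success+failures Ss) ⟩
      𝔼 runs (λ Ss → indicator (success? (best Ss)) + ∏[ failure ] Ss)
        ≈⟨ 𝔼-+ runs _ ∏[ failure ] ⟩
      𝔼 runs (indicator ∘ success? ∘ best) + 𝔼 runs ∏[ failure ]
        ≤⟨ +-mono-≤ (≤-reflexive Pr≈)
           (𝔼-∏-independently isRun (λ S → 0≤indicator (¬? (success? S)))
             (λ t → failure≤1-q^k (arb t) (valid t)) 0≤1-q^k n) ⟩
      Pr (bestOfRuns arb k n) success? + (1# - q ^ k) ^ n ∎
      where
      runs = independently (λ t → singleRun (arb t) k) n
      failure : Subset d → Carrier
      failure = indicator ∘ ¬? ∘ success?
      isRun : ∀ t → IsDistributionOn Always (singleRun (arb t) k)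
      isRun t = singleRun-isDistribution (arb t) (valid t) k k≤d
      isRuns = independently-isDistribution isRun n
      0≤1-q^k = x≤y⇒0≤y-x (x^n≤1 0≤q q≤1 k)
      Pr≈ : 𝔼 runs (indicator ∘ success? ∘ best) ≈ Pr (bestOfRuns arb k n) success?
      Pr≈ = sym (trans (Pr≈𝔼 (bestOfRuns arb k n) success?)
                       (𝔼-fmap runs best (indicator ∘ success?)))

-- The constants of the theorem and the one-step bound from weak modularity.

theorem3 :
    (ℝ : RealNumbers) →
    let open RealNumbers ℝ
        open Analysis ℝ
        open Probability ℝ
    in
    (d k : ℕ) .{{_ : NonZero d}} .{{_ : NonZero k}} → k ℕ.≤ d →
    (F : Subset d → Carrier) →
    let open SetFunction ℝ F in
    Monotone → Normalized →
    (γₖ βₖd : Carrier) →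
    IsMinSubmodularityRatio k k γₖ → IsMinSupermodularityRatio k d βₖd →
    WeaklyModular γₖ βₖd →
    (S* : Subset d) → OptimalSolution k S* →
    let F̃ = F ⊤ - F S* in
    (ε δ : Carrier) → 0# < ε → 0# < δ → δ < 1# →
    (logδ⁻¹ : Carrier) → IsLog (δ ⁻¹) logδ⁻¹ →
    (N : ℕ) → IsCeiling (((γₖ * βₖd) ⁻¹ * ((F̃ + ε) * ε ⁻¹)) ^ k * logδ⁻¹) N →
    (T : ℕ) → N ℕ.≤ T →
    (arb : ℕ → Fallback) → (∀ t → ValidFallback (arb t)) →
    1# - δ ≤ Pr (bestOfRuns arb k T) (λ S → (F S* - ε) ≤? F S)
theorem3 ℝ d k k≤d F monotone _ γ β isγ isβ
  ((cγ , 0<cγ , cγ≤γ) , (cβ , 0<cβ , cβ≤β)) S* (∣S*∣≤k , _)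
  ε δ 0<ε 0<δ _ l log N (Q^kl≤N , _) T N≤T arb valid =
  x≤z+y⇒x-y≤z $ begin
    1#                          ≤⟨ bestOfRuns-success arb valid T ⟩
    Pr (bestOfRuns arb k T) success? + (1# - q ^ k) ^ T
      ≤⟨ +-monoʳ-≤ _ (u^n≤δ T 0<δ log 0≤1-q^k (0≤^ 0≤q k) (//-rightDividesˡ (q ^ k) 1#) l≤Tq^k) ⟩
    Pr (bestOfRuns arb k T) success? + δ                ∎
  where
  open RealNumbers ℝ hiding (zero)
  open Analysis ℝ
  open Probability ℝ
  open SetFunction ℝ F
  open OrderedField ℝ
  open FiniteSums ℝ
  open Greedy ℝ F monotone
  open PartialOrderReasoning poset

  -- `Q` is the base of the power in the hypothesis on T. Its reciprocal `q` is written out factor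
  -- by factor so that `γ`, `β` and ε/B can be estimated separately.
  F̃ B Q q : Carrier
  F̃ = F ⊤ - F S*
  B = F̃ + ε
  Q = (γ * β) ⁻¹ * (B * ε ⁻¹)
  q = (γ * β) * (ε * B ⁻¹)

  0<γ : 0# < γ
  0<γ = <-≤-trans 0<cγ cγ≤γ

  0<β : 0# < β
  0<β = <-≤-trans 0<cβ cβ≤β

  -- The minimum is attained, so `γ` is the ratio of some set and inherits the upper bound built
  -- into ratios.
  γ≤1 : γ ≤ 1#
  γ≤1 = let _ , _ , (_ , γ≤1 , _) , _ = proj₁ isγ in γ≤1

  β≤1 : β ≤ 1#
  β≤1 = let _ , _ , (_ , β≤1 , _) , _ = proj₁ isβ in β≤1

  0≤F̃ : 0# ≤ F̃
  0≤F̃ = x≤y⇒0≤y-x (F-mono-≤ ⊆⊤)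

  ε≤B : ε ≤ B
  ε≤B = y≤x+y 0≤F̃

  0<B : 0# < B
  0<B = <-≤-trans 0<ε ε≤B

  0<γβ : 0# < γ * β
  0<γβ = *-pos 0<γ 0<β

  0≤ε/B : 0# ≤ ε * B ⁻¹
  0≤ε/B = <⇒≤ (*-pos 0<ε (0<⁻¹ 0<B))

  0≤q : 0# ≤ q
  0≤q = *-nonNeg (<⇒≤ 0<γβ) 0≤ε/B

  q≤1 : q ≤ 1#
  q≤1 = begin
    γ * β * (ε * B ⁻¹) ≤⟨ *-mono-≤ 0≤ε/B (*-nonNeg 0≤1 0≤1) (*-mono-≤ (<⇒≤ 0<β) 0≤1 γ≤1 β≤1)
                            (y≤x*z⇒y/z≤x 0<B (≤-respʳ-≈ (sym (*-identityˡ B)) ε≤B)) ⟩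
    1# * 1# * 1#       ≈⟨ trans (*-identityʳ _) (*-identityʳ 1#) ⟩
    1#                 ∎

  Qq≈1 : Q * q ≈ 1#
  Qq≈1 = begin-equality
    (γ * β) ⁻¹ * (B * ε ⁻¹) * (γ * β * (ε * B ⁻¹))
      ≈⟨ solve 6 (λ a a′ b b′ e e′ → a′ :* (b :* e′) :* (a :* (e :* b′))
                                    := a :* a′ :* (b :* b′) :* (e :* e′))
           refl (γ * β) ((γ * β) ⁻¹) B (B ⁻¹) ε (ε ⁻¹) ⟩
    γ * β * (γ * β) ⁻¹ * (B * B ⁻¹) * (ε * ε ⁻¹)
      ≈⟨ *-cong (*-cong (⁻¹-inverseʳ (pos⇒≉0 0<γβ)) (⁻¹-inverseʳ (pos⇒≉0 0<B)))
               (⁻¹-inverseʳ (pos⇒≉0 0<ε)) ⟩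
    1# * 1# * 1#
      ≈⟨ trans (*-identityʳ _) (*-identityʳ 1#) ⟩
    1# ∎

  -- Multiplying `Q ^ k * l ≤ T` by `q ^ k` cancels `Q ^ k`, because Q q = 1.
  l≤Tq^k : l ≤ fromℕ T * q ^ k
  l≤Tq^k = begin
    l                   ≈⟨ *-identityˡ l ⟨
    1# * l              ≈⟨ *-congʳ (1^n≈1 k) ⟨
    1# ^ k * l          ≈⟨ *-congʳ (^-cong Qq≈1 (≡.refl {x = k})) ⟨
    (Q * q) ^ k * l     ≈⟨ *-congʳ (^-distrib-* Q q k) ⟩
    Q ^ k * q ^ k * l
      ≈⟨ solve 3 (λ a b c → a :* b :* c := a :* c :* b) refl (Q ^ k) (q ^ k) l ⟩
    Q ^ k * l * q ^ k   ≤⟨ *-monoˡ-≤ (0≤^ 0≤q k) (≤-trans Q^kl≤N (fromℕ-mono-≤ N≤T)) ⟩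
    fromℕ T * q ^ k     ∎

  0≤1-q^k : 0# ≤ 1# - q ^ k
  0≤1-q^k = x≤y⇒0≤y-x (x^n≤1 0≤q q≤1 k)

  -- Positivity of the total gain comes from the same estimate as the probability bound: the gains
  -- in S* outside S already sum to at least γ x > 0. A run below the threshold is therefore never
  -- stuck.
  q-step : ∀ S → ∣ S ∣ ℕ.≤ k → F S < F S* - ε →
           0# < totalGain S × q * totalGain S ≤ ∑[ S* ∩ ∁ S ] (λ j → f⟨ j ∣ S ⟩)
  q-step S ∣S∣≤k FS<F*-ε = <-≤-trans 0<a a≤b , qb≤a
    where
    a b x : Carrier
    a = ∑[ S* ∩ ∁ S ] (λ j → f⟨ j ∣ S ⟩)
    b = totalGain S
    x = F S* - F S

    ε≤x : ε ≤ x
    ε≤x = +-cancelʳ-≤ (F S) $ begin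
      ε + F S        ≈⟨ +-comm ε (F S) ⟩
      F S + ε        ≤⟨ +-monoˡ-≤ ε (<⇒≤ FS<F*-ε) ⟩
      F S* - ε + ε   ≈⟨ //-rightDividesˡ ε (F S*) ⟩
      F S*           ≈⟨ //-rightDividesˡ (F S) (F S*) ⟨
      x + F S        ∎

    0<x : 0# < x
    0<x = <-≤-trans 0<ε ε≤x

    S*⊆S∪[S*∩∁S] : S* ⊆ S ∪ (S* ∩ ∁ S)
    S*⊆S∪[S*∩∁S] {j} j∈S* with j ∈? S
    ... | yes j∈S = p⊆p∪q (S* ∩ ∁ S) j∈S
    ... | no  j∉S = q⊆p∪q S (S* ∩ ∁ S) (x∈p∩q⁺ (j∈S* , x∉p⇒x∈∁p j∉S))

    γx≤a : γ * x ≤ a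
    γx≤a = begin
      γ * x
        ≤⟨ *-monoʳ-≤ (<⇒≤ 0<γ) (+-monoˡ-≤ (- F S) (F-mono-≤ S*⊆S∪[S*∩∁S])) ⟩
      γ * F⟨ S* ∩ ∁ S ∣ S ⟩      ≤⟨ γ-bound isγ S ∣S∣≤k S (S* ∩ ∁ S)
                                      (λ (j , j∈) → let j∈S , j∈T = x∈p∩q⁻ S _ j∈ in
                                        x∈∁p⇒x∉p (p∩q⊆q S* (∁ S) j∈T) j∈S)
                                      id (ℕₚ.≤-trans (∣p∩q∣≤∣p∣ S* (∁ S)) ∣S*∣≤k) ⟩
      a                          ∎

    -- F([d]) - F(S) is split at F(S*), so that the deficit `x` appears in both the upper and the
    -- lower estimate of the gains.
    βb≤x+F̃ : β * b ≤ x + F̃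
    βb≤x+F̃ = begin
      β * b            ≤⟨ β-bound isβ S ∣S∣≤k S (∁ S)
                            (λ (j , j∈) → let j∈S , j∈∁S = x∈p∩q⁻ S _ j∈ in x∈∁p⇒x∉p j∈∁S j∈S)
                            id (∣p∣≤n (∁ S)) ⟩
      F⟨ ∁ S ∣ S ⟩     ≤⟨ x≤z+y⇒x-y≤z (begin
        F (S ∪ ∁ S)    ≤⟨ F-mono-≤ ⊆⊤ ⟩
        F ⊤            ≈⟨ //-rightDividesˡ (F S*) (F ⊤) ⟨
        F̃ + F S*       ≈⟨ +-congˡ (//-rightDividesˡ (F S) (F S*)) ⟨
        F̃ + (x + F S)  ≈⟨ solve 3 (λ a b c → a :+ (b :+ c) := b :+ a :+ c) refl F̃ x (F S) ⟩
        x + F̃ + F S    ∎) ⟩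
      x + F̃            ∎

    0<a : 0# < a
    0<a = <-≤-trans (*-pos 0<γ 0<x) γx≤a

    a≤b : a ≤ b
    a≤b = sum-mono-≤ pointwise
      where
      pointwise : ∀ j → restrict (S* ∩ ∁ S) (λ i → f⟨ i ∣ S ⟩) j
                        ≤ restrict (∁ S) (λ i → f⟨ i ∣ S ⟩) j
      pointwise j with j ∈? S* ∩ ∁ S
      ... | yes j∈ = ≤-reflexive (sym (reflexive
        (restrict-∈ (λ i → f⟨ i ∣ S ⟩) (p∩q⊆q S* (∁ S) j∈))))
      ... | no _   = 0≤restrict (∁ S) (0≤f S) j

    -- This is ε / (F̃ + ε) ≤ x / (x + F̃) cross-multiplied. The right side increases with x, so the
    -- least deficit x = ε is the worst case; hence the factor (F̃ + ε) / ε in the number of runs.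
    [x+F̃]ε≤xB : (x + F̃) * ε ≤ x * B
    [x+F̃]ε≤xB = begin
      (x + F̃) * ε       ≈⟨ distribʳ ε x F̃ ⟩
      x * ε + F̃ * ε     ≤⟨ +-monoʳ-≤ (x * ε) (*-monoʳ-≤ 0≤F̃ ε≤x) ⟩
      x * ε + F̃ * x     ≈⟨ solve 3 (λ x e f → x :* e :+ f :* x := x :* (f :+ e)) refl x ε F̃ ⟩
      x * B             ∎

    qb≤a : q * b ≤ a
    qb≤a = begin
      γ * β * (ε * B ⁻¹) * b
        ≈⟨ solve 5 (λ g h e c b → g :* h :* (e :* c) :* b := g :* (h :* b :* e :* c))
           refl γ β ε (B ⁻¹) b ⟩
      γ * (β * b * ε * B ⁻¹)
        ≤⟨ *-monoʳ-≤ (<⇒≤ 0<γ) (y≤x*z⇒y/z≤x 0<B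
           (≤-trans (*-monoˡ-≤ (<⇒≤ 0<ε) βb≤x+F̃) [x+F̃]ε≤xB)) ⟩
      γ * x                         ≤⟨ γx≤a ⟩
      a                             ∎

  open Success S* (F S* - ε) q k k≤d (x≤z+y⇒x-y≤z (x≤x+y (<⇒≤ 0<ε))) ∣S*∣≤k 0≤q q≤1 q-step
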